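{- Let $K=\mathbb{Q}(\sqrt{D})$ where $D\in\mathbb{Z}_{\ge2}$ is squarefree and $D\equiv 2,3 \pmod 4$. Then there exist infinitely many $n\in\mathbb{Z}_{\ge1}$ such that $p_K(n)$ is odd and infinitely many $n\in\mathbb{Z}_{\ge1}$ such that $p_K(n)$ is even.
   Context: $\mathcal{O}_K$ is the ring of integers of $K$ and $\mathcal{O}_K^+$ is the set of totally positive elements of $\mathcal{O}_K$ (elements $\gamma$ with $\gamma>0$ and $\gamma'>0$, where $'$ denotes Galois conjugation). A partition of $\alpha\in\mathcal{O}_K^+$ is an expression $\alpha=\alpha_1+\dots+\alpha_k$ with $k\ge1$ and all $\alpha_i\in\mathcal{O}_K^+$, the order of the summands being irrelevant; $p_K(\alpha)$ is the number of partitions of $\alpha$. -}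

module Defs where

open import Data.Nat as ℕ using (ℕ)
open import Data.Nat.Divisibility using (_∣_)
open import Data.Integer as ℤ using (ℤ; +_; _<_; _≤_; _*_; _+_)
open import Data.Product using (_×_; _,_; Σ)
open import Data.Sum using (_⊎_)
open import Data.List using (List; []; _∷_; foldr; map)
open import Data.List.Relation.Unary.All using (All)
open import Relation.Binary.PropositionalEquality using (_≡_)

SquareFree : ℕ → Set
SquareFree d = (k : ℕ) → (k ℕ.* k) ∣ d → k ≡ 1

-- For D ≡ 2,3 (mod 4) squarefree, O_K = ℤ[√D]; an element a + b√D is
-- represented by the pair (a , b).
OK : Set
OK = ℤ × ℤ

-- Totally positive in ℤ[√D]: a + b√D > 0 and a − b√D > 0,
-- equivalently a > |b|√D, i.e. a > 0 and D b² < a².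
TotPos : ℕ → OK → Set
TotPos D (a , b) = (+ 0 < a) × ((+ D) * (b * b) < a * a)

_⊕_ : OK → OK → OK
(a , b) ⊕ (c , d) = (a + c , b + d)

sumOK : List OK → OK
sumOK = foldr _⊕_ (+ 0 , + 0)

-- A fixed total order on O_K (lexicographic), used only to represent
-- multisets (unordered partitions) canonically as sorted lists.
_≤ₗ_ : OK → OK → Set
(a , b) ≤ₗ (c , d) = (a < c) ⊎ ((a ≡ c) × (b ≤ d))

data Sorted : List OK → Set where
  []  : Sorted []
  [_] : ∀ x → Sorted (x ∷ [])
  _∷_ : ∀ {x y xs} → y ≤ₗ x → Sorted (y ∷ xs) → Sorted (x ∷ y ∷ xs)

-- Partitions of α ∈ O_K^+ in K = ℚ(√D): multisets of (at least one)
-- totally positive elements summing to α, represented as sorted lists.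
-- (k ≥ 1 is automatic for α ≠ 0 since the empty sum is 0.)
record Partition (D : ℕ) (α : OK) : Set where
  constructor mkPartition
  field
    parts  : List OK
    sorted : Sorted parts
    totpos : All (TotPos D) parts
    sums   : sumOK parts ≡ α

ι : ℕ → OK
ι n = (+ n , + 0)

Odd : ℕ → Set
Odd m = m ℕ.% 2 ≡ 1

Even : ℕ → Set
Even m = m ℕ.% 2 ≡ 0

{-# OPTIONS --safe #-}

-- Write wt (a + b√D) = a, and let p(α) be the number of partitions of α.  Logarithmic
-- differentiation of the product of (1 - x^δ)⁻¹ over the totally positive δ gives
-- wt(α) p(α) = Σ_δ wt(δ) Σ_{k≥1} p(α - kδ).  This recursion is stable under Galois
-- conjugation, hence so is p, and for α = n the terms of δ and δ′ cancel modulo 2.  Only the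
-- rational integers δ = a survive:  n p(n) ≡ Σ_{m=1}^{n} σ(m) p(n - m)  (mod 2).
--
-- If σ(m) is odd then m is a square or twice a square, so there are arbitrarily long intervals
-- on which σ is even.  Were p(n) even for all large n, take m with σ(m) odd just after such an
-- interval: the recurrence at m reads 0 ≡ p(0) = 1.  Were p(n) odd for all large n, the
-- recurrences at two consecutive n, n + 1 at the end of such an interval have the same right
-- hand side modulo 2, but n ≢ n + 1.
module Submission where

open import Defs
open import Data.Nat as ℕ using (ℕ; zero; suc; _≤_; _<_; _∸_; _%_; _+_; _*_; _^_; z≤n; s≤s; s≤s⁻¹; parity)
import Data.Nat.Properties as ℕₚ
open import Data.Nat.Coprimality using (Coprime; coprime-divisor)
open import Data.Nat.Divisibility using (_∣_; _∣?_; divides; ∣-refl; ∣m∣n⇒∣m+n; ∣m+n∣m⇒∣n; ∣⇒≤; ∣1⇒≡1)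
open import Data.Nat.ListAction using (sum)
open import Data.Nat.ListAction.Properties using (sum-++)
open import Data.Nat.Primality using (irreducible[2])
open import Data.Nat.Tactic.RingSolver using (solve-∀)
open import Data.Integer as ℤ using (ℤ; +_; -[1+_]; ∣_∣)
import Data.Integer.Properties as ℤₚ
import Data.Integer.Tactic.RingSolver as ℤSolver
open import Data.Parity.Base as ℙ using (Parity; 0ℙ; 1ℙ; _⁻¹)
import Data.Parity.Properties as ℙₚ
open import Data.Fin using (Fin)
open import Data.Fin.Properties using (+↔⊎)
open import Data.List using (List; []; _∷_; _++_; map)
open import Data.List.Properties using (map-++; ∷-injectiveʳ)
open import Data.List.Membership.Propositional using (_∈_)
open import Data.List.Membership.Propositional.Properties using (∈-++⁺ˡ; ∈-++⁺ʳ)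
open import Data.List.Relation.Unary.All as All using (All; []; _∷_)
import Data.List.Relation.Unary.All.Properties as All
open import Data.List.Relation.Unary.AllPairs using (AllPairs; []; _∷_)
import Data.List.Relation.Unary.AllPairs.Properties as AllPairs
open import Data.List.Relation.Unary.Any using (here; there)
open import Data.Product using (_×_; Σ; ∃; _,_; proj₁; proj₂)
open import Data.Product.Properties using (≡-dec)
open import Data.Sum using (_⊎_; inj₁; inj₂)
open import Data.Sum.Function.Propositional using (_⊎-↔_)
open import Data.Empty using (⊥; ⊥-elim)
open import Function using (_∘_)
open import Function.Bundles using (_↔_; mk↔ₛ′)
open import Function.Properties.Inverse using (↔-trans)
open import Algebra.Properties.CommutativeSemigroup ℕₚ.+-commutativeSemigroup using (interchange)
open import Relation.Nullary using (¬_; Dec; yes; no; contradiction)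
open import Relation.Binary.PropositionalEquality
  using (_≡_; _≢_; refl; sym; trans; cong; cong₂; subst; subst₂; ≢-sym; module ≡-Reasoning)
open import Relation.Binary.PropositionalEquality.WithK using (≡-irrelevant)

-- Conjugation, weight and subtraction in ℤ[√D].

conj : OK → OK
conj (a , b) = a , ℤ.- b

infixl 6 _⊖_
_⊖_ : OK → OK → OK
(a , b) ⊖ (c , d) = a ℤ.- c , b ℤ.- d

wt : OK → ℤ
wt = proj₁

-- A record, so that e can be inferred from a proof of Positive e.
record Positive (e : OK) : Set where
  constructor positive
  field 0<wt : + 0 ℤ.< wt e
open Positive

Supported : (OK → ℕ) → Set
Supported f = ∀ α → wt α ℤ.< + 0 → f α ≡ 0

⊖-swap : ∀ α β γ → (α ⊖ β) ⊖ γ ≡ (α ⊖ γ) ⊖ β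
⊖-swap (a , b) (c , d) (x , y) = cong₂ _,_ (swap a c x) (swap b d y)
  where
  swap : ∀ a c x → a ℤ.- c ℤ.- x ≡ a ℤ.- x ℤ.- c
  swap = ℤSolver.solve-∀

conj-⊖ : ∀ α β → conj (α ⊖ β) ≡ conj α ⊖ conj β
conj-⊖ (a , b) (c , d) = cong (a ℤ.- c ,_) (ℤₚ.neg-distrib-+ b (ℤ.- d))

wt-⊖-≤ : ∀ {e} → Positive e → ∀ α → wt (α ⊖ e) ℤ.≤ wt α ℤ.- + 1
wt-⊖-≤ e>0 α = ℤₚ.+-monoʳ-≤ (wt α) (ℤₚ.neg-mono-≤ (ℤₚ.i<j⇒suc[i]≤j (0<wt e>0)))

wt-⊖-< : ∀ {e k} → Positive e → ∀ α → wt α ℤ.< + suc k → wt (α ⊖ e) ℤ.< + k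
wt-⊖-< e>0 α α<k = ℤₚ.≤-<-trans (wt-⊖-≤ e>0 α) (ℤₚ.+-monoˡ-< (ℤ.- + 1) α<k)

wt-⊖-neg : ∀ {e} → Positive e → ∀ α → wt α ℤ.< + 0 → wt (α ⊖ e) ℤ.< + 0
wt-⊖-neg e>0 α α<0 = wt-⊖-< e>0 α (ℤₚ.<-trans α<0 (ℤ.+<+ (s≤s z≤n)))

<-suc-abs : ∀ i → i ℤ.< + suc ∣ i ∣
<-suc-abs (+ n)    = ℤ.+<+ ℕₚ.≤-refl
<-suc-abs -[1+ n ] = ℤ.-<+

-- Geometric series and their products.

-- The coefficient of x^α in f(x) · (1 + x^e + ⋯ + x^((k-1)e)).
geo≤ : ℕ → OK → (OK → ℕ) → OK → ℕ
geo≤ zero    e f α = 0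
geo≤ (suc k) e f α = f α + geo≤ k e f (α ⊖ e)

-- All further terms vanish when f is supported and e is positive.
geo : OK → (OK → ℕ) → OK → ℕ
geo e f α = geo≤ (suc ∣ wt α ∣) e f α

_≟_ : (α β : OK) → Dec (α ≡ β)
_≟_ = ≡-dec ℤ._≟_ ℤ._≟_

δ₀ : OK → ℕ
δ₀ α with α ≟ (+ 0 , + 0)
... | yes _ = 1
... | no  _ = 0

-- For positive entries `e`, the coefficient of x^α in the product of the series (1 - x^e)⁻¹.
count : List OK → OK → ℕ
count []      = δ₀
count (e ∷ L) = geo e (count L)

geo≤-neg : ∀ {e f} → Positive e → Supported f → ∀ k α → wt α ℤ.< + 0 → geo≤ k e f α ≡ 0
geo≤-neg e>0 supp zero    α α<0 = refl
geo≤-neg e>0 supp (suc k) α α<0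
  rewrite supp α α<0 = geo≤-neg e>0 supp k _ (wt-⊖-neg e>0 α α<0)

geo-supported : ∀ {e f} → Positive e → Supported f → Supported (geo e f)
geo-supported e>0 supp α = geo≤-neg e>0 supp (suc ∣ wt α ∣) α

-- Each shift by `e` lowers the weight by at least 1, so the terms beyond any length exceeding
-- `wt α` vanish.
geo≤-stable : ∀ {e f} → Positive e → Supported f → ∀ k l α →
  wt α ℤ.< + k → wt α ℤ.< + l → geo≤ k e f α ≡ geo≤ l e f α
geo≤-stable e>0 supp zero    l       α α<k α<l = sym (geo≤-neg e>0 supp l α α<k)
geo≤-stable e>0 supp (suc k) zero    α α<k α<l = geo≤-neg e>0 supp (suc k) α α<l
geo≤-stable {f = f} e>0 supp (suc k) (suc l) α α<k α<l =
  cong (λ z → f α + z) (geo≤-stable e>0 supp k l _ (wt-⊖-< e>0 α α<k) (wt-⊖-< e>0 α α<l))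

-- F/(1 - x^e) = F + x^e F/(1 - x^e); `geo≤-stable` reconciles the different truncations.
geo-unfold : ∀ {e f} → Positive e → Supported f → ∀ α → geo e f α ≡ f α + geo e f (α ⊖ e)
geo-unfold {e} {f} e>0 supp α =
  cong (λ z → f α + z) (geo≤-stable e>0 supp _ _ (α ⊖ e) (wt-⊖-< e>0 α (<-suc-abs _)) (<-suc-abs _))

δ₀-supported : Supported δ₀
δ₀-supported α α<0 with α ≟ (+ 0 , + 0)
... | yes refl = ⊥-elim (ℤₚ.<-irrefl refl α<0)
... | no  _    = refl

count-supported : ∀ {L} → All Positive L → Supported (count L)
count-supported []           = δ₀-supported
count-supported (e>0 ∷ L>0) = geo-supported e>0 (count-supported L>0)

-- Multisets over a list and their number.

-- The multiplicity of the head is the number of `take` steps before its `skip`, so a choice of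
-- multiplicities has exactly one derivation. The two constructors mirror the summands of
-- `geo-unfold`.
data Multiset : List OK → OK → Set where
  done : ∀ {α} → α ≡ (+ 0 , + 0) → Multiset [] α
  skip : ∀ {e L α} → Multiset L α → Multiset (e ∷ L) α
  take : ∀ {e L α} → Multiset (e ∷ L) (α ⊖ e) → Multiset (e ∷ L) α

Multiset-neg : ∀ {L α} → All Positive L → wt α ℤ.< + 0 → ¬ Multiset L α
Multiset-neg _           α<0 (done refl) = ℤₚ.<-irrefl refl α<0
Multiset-neg (_ ∷ L>0)   α<0 (skip p) = Multiset-neg L>0 α<0 p
Multiset-neg {α = α} (e>0 ∷ L>0) α<0 (take p) = Multiset-neg (e>0 ∷ L>0) (wt-⊖-neg e>0 α α<0) p

Multiset-unfold : ∀ {e L α} → (Multiset L α ⊎ Multiset (e ∷ L) (α ⊖ e)) ↔ Multiset (e ∷ L) α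
Multiset-unfold = mk↔ₛ′
  (λ { (inj₁ p) → skip p ; (inj₂ p) → take p })
  (λ { (skip p) → inj₁ p ; (take p) → inj₂ p })
  (λ { (skip p) → refl ; (take p) → refl })
  (λ { (inj₁ p) → refl ; (inj₂ p) → refl })

-- Both sides obey the same recursion: `skip` shortens the list, `take` lowers the weight, and at
-- negative weight both are empty.
count-Multiset : ∀ {L} → All Positive L → ∀ α → Fin (count L α) ↔ Multiset L α
count-Multiset {[]} _ α with α ≟ (+ 0 , + 0)
... | yes α≡0 = mk↔ₛ′ (λ _ → done α≡0) (λ _ → Fin.zero)
                  (λ { (done refl) → cong done (≡-irrelevant _ _) }) (λ { Fin.zero → refl ; (Fin.suc ()) })
... | no  α≢0 = mk↔ₛ′ (λ ()) (λ { (done α≡0) → ⊥-elim (α≢0 α≡0) })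
                  (λ { (done α≡0) → ⊥-elim (α≢0 α≡0) }) (λ ())
count-Multiset {e ∷ L} (e>0 ∷ L>0) α = go _ α (<-suc-abs _)
  where
  go : ∀ k α → wt α ℤ.< + k → Fin (count (e ∷ L) α) ↔ Multiset (e ∷ L) α
  go zero α α<0 =
    subst (λ n → Fin n ↔ Multiset (e ∷ L) α) (sym (count-supported (e>0 ∷ L>0) α α<0))
      (mk↔ₛ′ (λ ()) (⊥-elim ∘ Multiset-neg (e>0 ∷ L>0) α<0)
        (λ p → ⊥-elim (Multiset-neg (e>0 ∷ L>0) α<0 p)) (λ ()))
  go (suc k) α α<k =
    subst (λ n → Fin n ↔ Multiset (e ∷ L) α) (sym (geo-unfold e>0 (count-supported L>0) α))
      (↔-trans +↔⊎ (↔-trans (count-Multiset L>0 α ⊎-↔ go k (α ⊖ e) (wt-⊖-< e>0 α α<k)) Multiset-unfold))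

-- Partitions as multisets over a descending list.

_<ₗ_ : OK → OK → Set
(a , b) <ₗ (c , d) = (a ℤ.< c) ⊎ ((a ≡ c) × (b ℤ.< d))

≤-<ₗ-trans : ∀ {α β γ} → α ≤ₗ β → β <ₗ γ → α <ₗ γ
≤-<ₗ-trans (inj₁ p)          (inj₁ q)          = inj₁ (ℤₚ.<-trans p q)
≤-<ₗ-trans (inj₁ p)          (inj₂ (refl , q)) = inj₁ p
≤-<ₗ-trans (inj₂ (refl , p)) (inj₁ q)          = inj₁ q
≤-<ₗ-trans (inj₂ (refl , p)) (inj₂ (refl , q)) = inj₂ (refl , ℤₚ.≤-<-trans p q)

<ₗ⇒≤ₗ : ∀ {α β} → α <ₗ β → α ≤ₗ β
<ₗ⇒≤ₗ (inj₁ p)          = inj₁ p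
<ₗ⇒≤ₗ (inj₂ (refl , p)) = inj₂ (refl , ℤₚ.<⇒≤ p)

<ₗ-irrefl : ∀ {α} → ¬ α <ₗ α
<ₗ-irrefl (inj₁ p)       = ℤₚ.<-irrefl refl p
<ₗ-irrefl (inj₂ (_ , p)) = ℤₚ.<-irrefl refl p

≤ₗ-refl : ∀ {α} → α ≤ₗ α
≤ₗ-refl = inj₂ (refl , ℤₚ.≤-refl)

Descending : List OK → Set
Descending = AllPairs (λ α β → β <ₗ α)

parts : ∀ {L α} → Multiset L α → List OK
parts (done _)         = []
parts (skip p)         = parts p
parts (take {e = e} p) = e ∷ parts p

parts-∈ : ∀ {L α} (p : Multiset L α) → All (_∈ L) (parts p)
parts-∈ (done _) = []
parts-∈ (skip p) = All.map there (parts-∈ p)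
parts-∈ (take p) = here refl ∷ parts-∈ p

∷-sorted : ∀ {α xs} → All (_≤ₗ α) xs → Sorted xs → Sorted (α ∷ xs)
∷-sorted []      []      = [ _ ]
∷-sorted (p ∷ _) [ _ ]   = p ∷ [ _ ]
∷-sorted (p ∷ _) (q ∷ s) = p ∷ (q ∷ s)

parts-sorted : ∀ {L α} → Descending L → (p : Multiset L α) → Sorted (parts p)
parts-sorted _          (done _) = []
parts-sorted (_ ∷ L↓)   (skip p) = parts-sorted L↓ p
parts-sorted (e> ∷ L↓)  (take p) = ∷-sorted (All.map ≤e (parts-∈ p)) (parts-sorted (e> ∷ L↓) p)
  where
  ≤e : ∀ {x} → x ∈ _ → x ≤ₗ _
  ≤e (here refl) = ≤ₗ-refl
  ≤e (there x∈L) = <ₗ⇒≤ₗ (All.lookup e> x∈L)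

⊕-⊖ : ∀ e α → e ⊕ (α ⊖ e) ≡ α
⊕-⊖ (a , b) (c , d) = cong₂ _,_ (eq a c) (eq b d)
  where
  eq : ∀ a c → a ℤ.+ (c ℤ.- a) ≡ c
  eq = ℤSolver.solve-∀

⊖-⊕ : ∀ e α → (e ⊕ α) ⊖ e ≡ α
⊖-⊕ (a , b) (c , d) = cong₂ _,_ (eq a c) (eq b d)
  where
  eq : ∀ a c → a ℤ.+ c ℤ.- a ≡ c
  eq = ℤSolver.solve-∀

parts-sum : ∀ {L α} (p : Multiset L α) → sumOK (parts p) ≡ α
parts-sum (done α≡0)           = sym α≡0
parts-sum (skip p)             = parts-sum p
parts-sum {α = α} (take {e} p) = trans (cong (e ⊕_) (parts-sum p)) (⊕-⊖ e α)

-- `take` puts `e` in front, whereas after `skip` all parts come from the tail of the list and are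
-- strictly below `e`.
parts-injective : ∀ {L α} → Descending L → (p q : Multiset L α) → parts p ≡ parts q → p ≡ q
parts-injective _         (done _) (done _) eq = cong done (≡-irrelevant _ _)
parts-injective (_ ∷ L↓)  (skip p) (skip q) eq = cong skip (parts-injective L↓ p q eq)
parts-injective (e> ∷ L↓) (take p) (take q) eq = cong take (parts-injective (e> ∷ L↓) p q (∷-injectiveʳ eq))
parts-injective (e> ∷ L↓) (skip p) (take q) eq =
  ⊥-elim (<ₗ-irrefl (All.lookup e> (All.head (subst (All (_∈ _)) eq (parts-∈ p)))))
parts-injective (e> ∷ L↓) (take p) (skip q) eq =
  ⊥-elim (<ₗ-irrefl (All.lookup e> (All.head (subst (All (_∈ _)) (sym eq) (parts-∈ q)))))

sorted-below : ∀ {α β xs} → Sorted (β ∷ xs) → β <ₗ α → All (_<ₗ α) (β ∷ xs)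
sorted-below [ _ ]   β<α = β<α ∷ []
sorted-below (γ≤β ∷ s) β<α = β<α ∷ sorted-below s (≤-<ₗ-trans γ≤β β<α)

sorted-tail : ∀ {x xs} → Sorted (x ∷ xs) → Sorted xs
sorted-tail [ _ ]   = []
sorted-tail (_ ∷ s) = s

remove-head : ∀ {e L xs} → All (_<ₗ e) xs → All (_∈ (e ∷ L)) xs → All (_∈ L) xs
remove-head []        []               = []
remove-head (x<e ∷ _) (here refl ∷ _)  = ⊥-elim (<ₗ-irrefl x<e)
remove-head (_ ∷ <e)  (there x∈L ∷ ∈L) = x∈L ∷ remove-head <e ∈L

-- The head of `xs` decides: if it is `e`, use `take`; if it lies further down the list, sortedness
-- puts all of `xs` strictly below `e`, and `skip` applies.
parts-surjective : ∀ {L} → Descending L → ∀ xs → Sorted xs → All (_∈ L) xs → ∀ {α} → sumOK xs ≡ α →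
  Σ (Multiset L α) λ p → parts p ≡ xs
parts-surjective {[]}    _        []       _ _        refl = done refl , refl
parts-surjective {[]}    _        (x ∷ xs) _ (() ∷ _) _
parts-surjective {e ∷ L} (_ ∷ L↓) []       s _        eq =
  let p , ≡xs = parts-surjective L↓ [] s [] eq in skip p , ≡xs
parts-surjective {e ∷ L} (e> ∷ L↓) (.e ∷ xs) s (here refl ∷ ∈L) {α} eq =
  let p , ≡xs = parts-surjective (e> ∷ L↓) xs (sorted-tail s) ∈L
                  (trans (sym (⊖-⊕ e (sumOK xs))) (cong (_⊖ e) eq))
  in take p , cong (e ∷_) ≡xs
parts-surjective {e ∷ L} (e> ∷ L↓) (x ∷ xs) s (there x∈L ∷ ∈L) eq =
  let p , ≡xs = parts-surjective L↓ (x ∷ xs) s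
                  (remove-head (sorted-below s (All.lookup e> x∈L)) (there x∈L ∷ ∈L)) eq
  in skip p , ≡xs

≤ₗ-irrelevant : ∀ {α β} (p q : α ≤ₗ β) → p ≡ q
≤ₗ-irrelevant (inj₁ p) (inj₁ q) = cong inj₁ (ℤₚ.<-irrelevant p q)
≤ₗ-irrelevant (inj₁ p) (inj₂ (refl , _)) = ⊥-elim (ℤₚ.<-irrefl refl p)
≤ₗ-irrelevant (inj₂ (refl , _)) (inj₁ p) = ⊥-elim (ℤₚ.<-irrefl refl p)
≤ₗ-irrelevant (inj₂ (eq , p)) (inj₂ (eq′ , q)) =
  cong inj₂ (cong₂ _,_ (≡-irrelevant eq eq′) (ℤₚ.≤-irrelevant p q))

Sorted-irrelevant : ∀ {xs} (s t : Sorted xs) → s ≡ t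
Sorted-irrelevant []      []      = refl
Sorted-irrelevant [ _ ]   [ _ ]   = refl
Sorted-irrelevant (p ∷ s) (q ∷ t) = cong₂ _∷_ (≤ₗ-irrelevant p q) (Sorted-irrelevant s t)

TotPos-irrelevant : ∀ {D α} (p q : TotPos D α) → p ≡ q
TotPos-irrelevant (p , q) (p′ , q′) = cong₂ _,_ (ℤₚ.<-irrelevant p p′) (ℤₚ.<-irrelevant q q′)

Partition-≡ : ∀ {D α} {P Q : Partition D α} → Partition.parts P ≡ Partition.parts Q → P ≡ Q
Partition-≡ {D} {P = mkPartition xs s t e} {mkPartition .xs s′ t′ e′} refl
  rewrite Sorted-irrelevant s s′ | All.irrelevant (λ {α} → TotPos-irrelevant {D} {α}) t t′ | ≡-irrelevant e e′ = refl

-- `L` has to contain only those elements that occur in partitions of `α`, so a finite list can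
-- stand for the infinite set of totally positive elements.
Partition↔Multiset : ∀ {D L α} → Descending L → All (TotPos D) L →
  (∀ (P : Partition D α) → All (_∈ L) (Partition.parts P)) → Multiset L α ↔ Partition D α
Partition↔Multiset {D} {L} {α} L↓ L≫0 parts∈L = mk↔ₛ′ to (proj₁ ∘ from)
  (λ P → Partition-≡ (proj₂ (from P)))
  (λ p → parts-injective L↓ _ p (proj₂ (from (to p))))
  where
  to : Multiset L α → Partition D α
  to p = mkPartition (parts p) (parts-sorted L↓ p) (All.map (All.lookup L≫0) (parts-∈ p)) (parts-sum p)
  from : (P : Partition D α) → Σ (Multiset L α) λ p → parts p ≡ Partition.parts P
  from P = parts-surjective L↓ _ (Partition.sorted P) (parts∈L P) (Partition.sums P)

-- The recursion from logarithmic differentiation.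

geo≤-cong : ∀ {f g : OK → ℕ} k e α → (∀ β → f β ≡ g β) → geo≤ k e f α ≡ geo≤ k e g α
geo≤-cong zero    e α f≡g = refl
geo≤-cong (suc k) e α f≡g = cong₂ _+_ (f≡g α) (geo≤-cong k e (α ⊖ e) f≡g)

geo≤-+ : ∀ (f g : OK → ℕ) k e α → geo≤ k e (λ β → f β + g β) α ≡ geo≤ k e f α + geo≤ k e g α
geo≤-+ f g zero    e α = refl
geo≤-+ f g (suc k) e α rewrite geo≤-+ f g k e (α ⊖ e) =
  interchange (f α) (g α) (geo≤ k e f (α ⊖ e)) (geo≤ k e g (α ⊖ e))

geo≤-shift : ∀ (f : OK → ℕ) k e d α → geo≤ k e (λ β → f (β ⊖ d)) α ≡ geo≤ k e f (α ⊖ d)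
geo≤-shift f zero    e d α = refl
geo≤-shift f (suc k) e d α =
  cong (λ z → f (α ⊖ d) + z) (trans (geo≤-shift f k e d (α ⊖ e)) (cong (geo≤ k e f) (⊖-swap α e d)))

-- `geo d` is additive and commutes with shifts, so it can be applied to `geo-unfold` for `e`. This
-- carries the sum over the old entries through the new factor in `wt*count`.
geo-geo-unfold : ∀ {d e f} → Positive d → Positive e → Supported f → ∀ α →
  geo d (geo e f) α ≡ geo d f α + geo d (geo e f) (α ⊖ e)
geo-geo-unfold {d} {e} {f} d>0 e>0 supp α = begin
  geo d (geo e f) α
    ≡⟨ geo≤-cong (suc K) d α (geo-unfold e>0 supp) ⟩
  geo≤ (suc K) d (λ β → f β + geo e f (β ⊖ e)) α
    ≡⟨ geo≤-+ f _ (suc K) d α ⟩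
  geo d f α + geo≤ (suc K) d (λ β → geo e f (β ⊖ e)) α
    ≡⟨ cong (λ z → geo d f α + z) (geo≤-shift (geo e f) (suc K) d e α) ⟩
  geo d f α + geo≤ (suc K) d (geo e f) (α ⊖ e)
    ≡⟨ cong (λ z → geo d f α + z)
         (geo≤-stable d>0 (geo-supported e>0 supp) (suc K) _ (α ⊖ e)
           (ℤₚ.<-trans (wt-⊖-< e>0 α (<-suc-abs (wt α))) (ℤ.+<+ ℕₚ.≤-refl)) (<-suc-abs _)) ⟩
  geo d f α + geo d (geo e f) (α ⊖ e) ∎
  where
  open ≡-Reasoning
  K = ∣ wt α ∣

sumOver : (OK → ℕ) → List OK → ℕ
sumOver h L = sum (map h L)

sumOver-cong : ∀ {f g : OK → ℕ} {L} → All (λ d → f d ≡ g d) L → sumOver f L ≡ sumOver g L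
sumOver-cong []          = refl
sumOver-cong (eq ∷ eqs) = cong₂ _+_ eq (sumOver-cong eqs)

sumOver-zero : ∀ {f : OK → ℕ} {L} → All (λ d → f d ≡ 0) L → sumOver f L ≡ 0
sumOver-zero []          = refl
sumOver-zero (eq ∷ eqs) rewrite eq = sumOver-zero eqs

sumOver-+ : ∀ (f g : OK → ℕ) L → sumOver (λ d → f d + g d) L ≡ sumOver f L + sumOver g L
sumOver-+ f g []      = refl
sumOver-+ f g (d ∷ L) rewrite sumOver-+ f g L = interchange (f d) (g d) (sumOver f L) (sumOver g L)

∣i∣≡∣i-j∣+∣j∣ : ∀ i j → + 0 ℤ.≤ i ℤ.- j → + 0 ℤ.< j → ∣ i ∣ ≡ ∣ i ℤ.- j ∣ + ∣ j ∣
∣i∣≡∣i-j∣+∣j∣ i (+ n) 0≤i-j _ with i ℤ.- + n in eq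
∣i∣≡∣i-j∣+∣j∣ i (+ n) (ℤ.+≤+ _) _ | + m = cong ∣_∣ (trans (sym (split i (+ n))) (cong (ℤ._+ + n) eq))
  where
  split : ∀ i j → i ℤ.- j ℤ.+ j ≡ i
  split = ℤSolver.solve-∀

-- The weight is additive; where `wt (α ⊖ e)` is negative and absolute values spoil this, the factor
-- `f (α ⊖ e)` is zero.
wt-split : ∀ {e f} → Positive e → Supported f → ∀ α →
  ∣ wt α ∣ * f (α ⊖ e) ≡ (∣ wt (α ⊖ e) ∣ + ∣ wt e ∣) * f (α ⊖ e)
wt-split {e} {f} e>0 supp α with wt (α ⊖ e) ℤ.<? + 0
... | yes <0 rewrite supp (α ⊖ e) <0 | ℕₚ.*-zeroʳ ∣ wt α ∣ =
  sym (ℕₚ.*-zeroʳ (∣ wt (α ⊖ e) ∣ + ∣ wt e ∣))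
... | no ≮0 = cong (_* f (α ⊖ e)) (∣i∣≡∣i-j∣+∣j∣ (wt α) (wt e) (ℤₚ.≮⇒≥ ≮0) (0<wt e>0))

-- Logarithmic differentiation of ∏ (1 - x^d)⁻¹ along wt.
wt*count : ∀ {L} → All Positive L → ∀ α →
  ∣ wt α ∣ * count L α ≡ sumOver (λ d → ∣ wt d ∣ * geo d (count L) (α ⊖ d)) L
wt*count {[]} [] α with α ≟ (+ 0 , + 0)
... | yes refl = refl
... | no  _    = ℕₚ.*-zeroʳ ∣ wt α ∣
wt*count {e ∷ L} (e>0 ∷ L>0) α = go _ α (<-suc-abs _)
  where
  open ≡-Reasoning
  C C′ : OK → ℕ
  C  = count L
  C′ = count (e ∷ L)

  C-supp : Supported C
  C-supp = count-supported L>0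

  C′-supp : Supported C′
  C′-supp = count-supported (e>0 ∷ L>0)

  rhs : OK → ℕ
  rhs α = sumOver (λ d → ∣ wt d ∣ * geo d C′ (α ⊖ d)) L

  rhs-unfold : ∀ α → rhs α ≡ ∣ wt α ∣ * C α + rhs (α ⊖ e)
  rhs-unfold α = begin
    rhs α
      ≡⟨ sumOver-cong (All.map (λ {d} d>0 → trans
           (cong (∣ wt d ∣ *_) (trans (geo-geo-unfold d>0 e>0 C-supp (α ⊖ d))
             (cong (λ β → geo d C (α ⊖ d) + geo d C′ β) (⊖-swap α d e))))
           (ℕₚ.*-distribˡ-+ ∣ wt d ∣ _ _)) L>0) ⟩
    sumOver (λ d → ∣ wt d ∣ * geo d C (α ⊖ d) + ∣ wt d ∣ * geo d C′ (α ⊖ e ⊖ d)) L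
      ≡⟨ sumOver-+ _ _ L ⟩
    sumOver (λ d → ∣ wt d ∣ * geo d C (α ⊖ d)) L + rhs (α ⊖ e)
      ≡⟨ cong (_+ rhs (α ⊖ e)) (wt*count L>0 α) ⟨
    ∣ wt α ∣ * C α + rhs (α ⊖ e) ∎

  go : ∀ k α → wt α ℤ.< + k → ∣ wt α ∣ * C′ α ≡ ∣ wt e ∣ * geo e C′ (α ⊖ e) + rhs α
  go zero α α<0 = begin
    ∣ wt α ∣ * C′ α ≡⟨ cong (∣ wt α ∣ *_) (C′-supp α α<0) ⟩
    ∣ wt α ∣ * 0    ≡⟨ ℕₚ.*-zeroʳ ∣ wt α ∣ ⟩
    0               ≡⟨ sumOver-zero (All.map vanish (e>0 ∷ L>0)) ⟨
    sumOver (λ d → ∣ wt d ∣ * geo d C′ (α ⊖ d)) (e ∷ L) ∎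
    where
    vanish : ∀ {d} → Positive d → ∣ wt d ∣ * geo d C′ (α ⊖ d) ≡ 0
    vanish {d} d>0 = trans (cong (∣ wt d ∣ *_) (geo-supported d>0 C′-supp (α ⊖ d) (wt-⊖-neg d>0 α α<0)))
                       (ℕₚ.*-zeroʳ ∣ wt d ∣)
  go (suc k) α α<k = begin
    ∣ wt α ∣ * C′ α
      ≡⟨ cong (∣ wt α ∣ *_) (geo-unfold e>0 C-supp α) ⟩
    ∣ wt α ∣ * (C α + C′ (α ⊖ e))
      ≡⟨ ℕₚ.*-distribˡ-+ ∣ wt α ∣ _ _ ⟩
    ∣ wt α ∣ * C α + ∣ wt α ∣ * C′ (α ⊖ e)
      ≡⟨ cong (λ z → ∣ wt α ∣ * C α + z) (wt-split e>0 C′-supp α) ⟩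
    ∣ wt α ∣ * C α + (∣ wt (α ⊖ e) ∣ + ∣ wt e ∣) * C′ (α ⊖ e)
      -- This is the induction hypothesis at `α ⊖ e`. The leftover `∣ wt e ∣ * C′ (α ⊖ e)` is the
      -- first term of the geometric series of the new entry.
      ≡⟨ cong (λ z → ∣ wt α ∣ * C α + z) (trans (ℕₚ.*-distribʳ-+ (C′ (α ⊖ e)) ∣ wt (α ⊖ e) ∣ _)
           (cong (_+ ∣ wt e ∣ * C′ (α ⊖ e)) (go k (α ⊖ e) (wt-⊖-< e>0 α α<k)))) ⟩
    ∣ wt α ∣ * C α + (∣ wt e ∣ * geo e C′ (α ⊖ e ⊖ e) + rhs (α ⊖ e) + ∣ wt e ∣ * C′ (α ⊖ e))
      ≡⟨ rearrange (∣ wt α ∣ * C α) ∣ wt e ∣ (geo e C′ (α ⊖ e ⊖ e)) (rhs (α ⊖ e)) (C′ (α ⊖ e)) ⟩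
    ∣ wt e ∣ * (C′ (α ⊖ e) + geo e C′ (α ⊖ e ⊖ e)) + (∣ wt α ∣ * C α + rhs (α ⊖ e))
      ≡⟨ cong₂ (λ x y → ∣ wt e ∣ * x + y) (geo-unfold e>0 C′-supp (α ⊖ e)) (rhs-unfold α) ⟨
    ∣ wt e ∣ * geo e C′ (α ⊖ e) + rhs α ∎
    where
    rearrange : ∀ a w g r c → a + (w * g + r + w * c) ≡ w * (c + g) + (a + r)
    rearrange = solve-∀

-- Invariance of the count under conjugation.

-- Closure under conjugation, with multiplicity, expressed without naming a permutation.
ConjInvariant : List OK → Set
ConjInvariant L = ∀ h → sumOver (h ∘ conj) L ≡ sumOver h L

-- Invariance of `f` is assumed only below weight `k`, so that `count-conj` can supply its induction
-- hypothesis.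
geo≤-conj : ∀ {f e} k → Positive e → (∀ β → wt β ℤ.< + k → f (conj β) ≡ f β) →
  ∀ j α → wt α ℤ.< + k → geo≤ j (conj e) f (conj α) ≡ geo≤ j e f α
geo≤-conj k e>0 f-conj zero    α α<k = refl
geo≤-conj {f} {e} k e>0 f-conj (suc j) α α<k = cong₂ _+_ (f-conj α α<k)
  (trans (cong (geo≤ j (conj e) f) (sym (conj-⊖ α e)))
    (geo≤-conj k e>0 f-conj j (α ⊖ e) (wt-⊖-< e>0 α (ℤₚ.<-trans α<k (ℤ.+<+ ℕₚ.≤-refl)))))

δ₀-conj : ∀ b → δ₀ (+ 0 , ℤ.- b) ≡ δ₀ (+ 0 , b)
δ₀-conj (+ zero)  = refl
δ₀-conj (+ suc _) = refl
δ₀-conj -[1+ _ ]  = refl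

-- A positive part would push the weight below zero, so only the empty multiset counts. In
-- particular p(0) = 1.
count-wt-zero : ∀ {L} → All Positive L → ∀ b → count L (+ 0 , b) ≡ δ₀ (+ 0 , b)
count-wt-zero []          b = refl
count-wt-zero {e ∷ L} (e>0 ∷ L>0) b = begin
  count (e ∷ L) (+ 0 , b)
    ≡⟨ geo-unfold e>0 (count-supported L>0) (+ 0 , b) ⟩
  count L (+ 0 , b) + count (e ∷ L) ((+ 0 , b) ⊖ e)
    ≡⟨ cong₂ _+_ (count-wt-zero L>0 b)
         (count-supported (e>0 ∷ L>0) _ (wt-⊖-< e>0 (+ 0 , b) (ℤ.+<+ (s≤s z≤n)))) ⟩
  δ₀ (+ 0 , b) + 0
    ≡⟨ ℕₚ.+-identityʳ _ ⟩
  δ₀ (+ 0 , b) ∎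
  where open ≡-Reasoning

-- Reordering the factors of the generating function is avoided: wt*count determines count L recursively.
count-conj : ∀ {L} → All Positive L → ConjInvariant L → ∀ α → count L (conj α) ≡ count L α
count-conj {L} L>0 L-conj α = go _ α (<-suc-abs _)
  where
  open ≡-Reasoning
  go : ∀ k α → wt α ℤ.< + k → count L (conj α) ≡ count L α
  go zero    α α<k = trans (count-supported L>0 (conj α) α<k) (sym (count-supported L>0 α α<k))
  go (suc k) (-[1+ a ] , b) α<k =
    trans (count-supported L>0 (-[1+ a ] , ℤ.- b) ℤ.-<+) (sym (count-supported L>0 (-[1+ a ] , b) ℤ.-<+))
  -- At weight zero `wt*count` reads 0 = 0 and determines nothing.
  go (suc k) (+ zero , b) α<k =
    trans (count-wt-zero L>0 (ℤ.- b)) (trans (δ₀-conj b) (sym (count-wt-zero L>0 b)))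
  go (suc k) α@(+ suc a , b) α<k = ℕₚ.*-cancelˡ-≡ _ _ (suc a) (begin
    suc a * count L (conj α)
      ≡⟨ wt*count L>0 (conj α) ⟩
    sumOver (λ d → ∣ wt d ∣ * geo d (count L) (conj α ⊖ d)) L
      ≡⟨ L-conj _ ⟨
    sumOver (λ d → ∣ wt d ∣ * geo (conj d) (count L) (conj α ⊖ conj d)) L
      ≡⟨ sumOver-cong (All.map (λ {d} d>0 → cong (∣ wt d ∣ *_) (trans
           (cong (geo (conj d) (count L)) (sym (conj-⊖ α d)))
           (geo≤-conj k d>0 (go k) (suc ∣ wt (α ⊖ d) ∣) (α ⊖ d) (wt-⊖-< d>0 α α<k)))) L>0) ⟩
    sumOver (λ d → ∣ wt d ∣ * geo d (count L) (α ⊖ d)) L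
      ≡⟨ wt*count L>0 α ⟨
    suc a * count L α ∎)

-- Finite sums over 1, ..., n.

Σ₁ : ℕ → (ℕ → ℕ) → ℕ
Σ₁ zero    f = 0
Σ₁ (suc n) f = Σ₁ n f + f (suc n)

Σ₁-cong-parity : ∀ n {f g : ℕ → ℕ} → (∀ i → 1 ≤ i → i ≤ n → parity (f i) ≡ parity (g i)) →
  parity (Σ₁ n f) ≡ parity (Σ₁ n g)
Σ₁-cong-parity zero    f≡g = refl
Σ₁-cong-parity (suc n) {f} {g} f≡g = begin
  parity (Σ₁ n f + f (suc n))             ≡⟨ ℙₚ.+-homo-+ (Σ₁ n f) _ ⟩
  parity (Σ₁ n f) ℙ.+ parity (f (suc n))  ≡⟨ cong₂ ℙ._+_
    (Σ₁-cong-parity n (λ i 1≤i i≤n → f≡g i 1≤i (ℕₚ.m≤n⇒m≤1+n i≤n)))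
    (f≡g (suc n) (s≤s z≤n) ℕₚ.≤-refl) ⟩
  parity (Σ₁ n g) ℙ.+ parity (g (suc n))  ≡⟨ ℙₚ.+-homo-+ (Σ₁ n g) _ ⟨
  parity (Σ₁ n g + g (suc n))             ∎
  where open ≡-Reasoning

Σ₁-cong : ∀ n {f g : ℕ → ℕ} → (∀ i → 1 ≤ i → i ≤ n → f i ≡ g i) → Σ₁ n f ≡ Σ₁ n g
Σ₁-cong zero    f≡g = refl
Σ₁-cong (suc n) f≡g = cong₂ _+_ (Σ₁-cong n (λ i 1≤i i≤n → f≡g i 1≤i (ℕₚ.m≤n⇒m≤1+n i≤n)))
                                 (f≡g (suc n) (s≤s z≤n) ℕₚ.≤-refl)

Σ₁-zero : ∀ n → Σ₁ n (λ _ → 0) ≡ 0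
Σ₁-zero zero    = refl
Σ₁-zero (suc n) rewrite Σ₁-zero n = refl

Σ₁-+ : ∀ n (f g : ℕ → ℕ) → Σ₁ n (λ i → f i + g i) ≡ Σ₁ n f + Σ₁ n g
Σ₁-+ zero    f g = refl
Σ₁-+ (suc n) f g rewrite Σ₁-+ n f g = interchange (Σ₁ n f) (Σ₁ n g) (f (suc n)) (g (suc n))

Σ₁-*ˡ : ∀ n c (f : ℕ → ℕ) → c * Σ₁ n f ≡ Σ₁ n (λ i → c * f i)
Σ₁-*ˡ zero    c f = ℕₚ.*-zeroʳ c
Σ₁-*ˡ (suc n) c f = trans (ℕₚ.*-distribˡ-+ c (Σ₁ n f) _) (cong (_+ c * f (suc n)) (Σ₁-*ˡ n c f))

Σ₁-*ʳ : ∀ n c (f : ℕ → ℕ) → Σ₁ n f * c ≡ Σ₁ n (λ i → f i * c)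
Σ₁-*ʳ zero    c f = refl
Σ₁-*ʳ (suc n) c f = trans (ℕₚ.*-distribʳ-+ c (Σ₁ n f) _) (cong (_+ f (suc n) * c) (Σ₁-*ʳ n c f))

Σ₁-swap : ∀ m n (f : ℕ → ℕ → ℕ) → Σ₁ m (λ i → Σ₁ n (f i)) ≡ Σ₁ n (λ j → Σ₁ m (λ i → f i j))
Σ₁-swap zero    n f = sym (Σ₁-zero n)
Σ₁-swap (suc m) n f rewrite Σ₁-swap m n f = sym (Σ₁-+ n (λ j → Σ₁ m (λ i → f i j)) (f (suc m)))

Σ₁-split : ∀ m n (f : ℕ → ℕ) → Σ₁ (m + n) f ≡ Σ₁ m f + Σ₁ n (λ i → f (m + i))
Σ₁-split m zero    f rewrite ℕₚ.+-identityʳ m = sym (ℕₚ.+-identityʳ _)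
Σ₁-split m (suc n) f rewrite ℕₚ.+-suc m n | Σ₁-split m n f = ℕₚ.+-assoc (Σ₁ m f) _ _

-- The totally positive elements of bounded weight.

-- Conjugate entries are put at opposite ends, which makes the row descending and symmetric.
row : ℕ → ℕ → ℕ → List OK
row D a zero    = (+ a , + 0) ∷ []
row D a (suc b) with + D ℤ.* (+ suc b ℤ.* + suc b) ℤ.<? + a ℤ.* + a
... | yes _ = (+ a , + suc b) ∷ row D a b ++ (+ a , -[1+ b ]) ∷ []
... | no  _ = row D a b

-- The bound ∣ b ∣ ≤ a on the second coordinate excludes no totally positive element when D ≥ 1.
ground : ℕ → ℕ → List OK
ground D zero    = []
ground D (suc n) = row D (suc n) (suc n) ++ ground D n

row-TotPos : ∀ D a b → 1 ≤ a → All (TotPos D) (row D a b)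
row-TotPos D (suc a) zero _ =
  (ℤ.+<+ (s≤s z≤n) , subst (ℤ._< + suc a ℤ.* + suc a) (sym (ℤₚ.*-zeroʳ (+ D))) (ℤ.+<+ (s≤s z≤n))) ∷ []
row-TotPos D a (suc b) 1≤a with + D ℤ.* (+ suc b ℤ.* + suc b) ℤ.<? + a ℤ.* + a
... | yes p = (ℤ.+<+ 1≤a , p) ∷ All.++⁺ (row-TotPos D a b 1≤a) ((ℤ.+<+ 1≤a , p) ∷ [])
... | no  _ = row-TotPos D a b 1≤a

row-bounded : ∀ D a b → All (λ α → wt α ≡ + a × ∣ proj₂ α ∣ ≤ b) (row D a b)
row-bounded D a zero = (refl , z≤n) ∷ []
row-bounded D a (suc b) with + D ℤ.* (+ suc b ℤ.* + suc b) ℤ.<? + a ℤ.* + a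
... | yes _ = (refl , ℕₚ.≤-refl) ∷
  All.++⁺ (All.map (λ (p , q) → p , ℕₚ.m≤n⇒m≤1+n q) (row-bounded D a b)) ((refl , ℕₚ.≤-refl) ∷ [])
... | no  _ = All.map (λ (p , q) → p , ℕₚ.m≤n⇒m≤1+n q) (row-bounded D a b)

∣i∣≤n⇒i<1+n : ∀ i {n} → ∣ i ∣ ≤ n → i ℤ.< + suc n
∣i∣≤n⇒i<1+n (+ m)    m≤n = ℤ.+<+ (s≤s m≤n)
∣i∣≤n⇒i<1+n -[1+ m ] _   = ℤ.-<+

∣i∣≤n⇒-1-n<i : ∀ i {n} → ∣ i ∣ ≤ n → -[1+ n ] ℤ.< i
∣i∣≤n⇒-1-n<i (+ m)    _   = ℤ.-<+
∣i∣≤n⇒-1-n<i -[1+ m ] m<n = ℤ.-<- m<n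

row-descending : ∀ D a b → Descending (row D a b)
row-descending D a zero = [] ∷ []
row-descending D a (suc b) with + D ℤ.* (+ suc b ℤ.* + suc b) ℤ.<? + a ℤ.* + a
... | yes _ =
  All.++⁺ (All.map (λ {α} (p , q) → inj₂ (p , ∣i∣≤n⇒i<1+n (proj₂ α) q)) (row-bounded D a b))
    (inj₂ (refl , ℤ.-<+) ∷ []) ∷
  AllPairs.++⁺ (row-descending D a b) ([] ∷ [])
    (All.map (λ {α} (p , q) → inj₂ (sym p , ∣i∣≤n⇒-1-n<i (proj₂ α) q) ∷ []) (row-bounded D a b))
... | no  _ = row-descending D a b

ground-bounded : ∀ D n → All (λ α → wt α ℤ.≤ + n) (ground D n)
ground-bounded D zero    = []
ground-bounded D (suc n) = All.++⁺
  (All.map (λ (p , _) → ℤₚ.≤-reflexive p) (row-bounded D (suc n) (suc n)))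
  (All.map (λ p → ℤₚ.≤-trans p (ℤ.+≤+ (ℕₚ.n≤1+n n))) (ground-bounded D n))

ground-descending : ∀ D n → Descending (ground D n)
ground-descending D zero    = []
ground-descending D (suc n) = AllPairs.++⁺ (row-descending D (suc n) (suc n)) (ground-descending D n)
  (All.map (λ { (refl , _) → All.map (λ p → inj₁ (ℤₚ.≤-<-trans p (ℤ.+<+ ℕₚ.≤-refl))) (ground-bounded D n) })
    (row-bounded D (suc n) (suc n)))

ground-TotPos : ∀ D n → All (TotPos D) (ground D n)
ground-TotPos D zero    = []
ground-TotPos D (suc n) = All.++⁺ (row-TotPos D (suc n) (suc n) (s≤s z≤n)) (ground-TotPos D n)

ground-positive : ∀ D n → All Positive (ground D n)
ground-positive D n = All.map (positive ∘ proj₁) (ground-TotPos D n)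

row-complete : ∀ D a b y → ∣ y ∣ ≤ b → TotPos D (+ a , y) → (+ a , y) ∈ row D a b
row-complete D a zero    (+ zero) _ _ = here refl
row-complete D a (suc b) y ∣y∣≤1+b α≫0
  with + D ℤ.* (+ suc b ℤ.* + suc b) ℤ.<? + a ℤ.* + a | ℕₚ.m≤n⇒m<n∨m≡n ∣y∣≤1+b
... | yes _ | inj₁ ∣y∣<1+b = there (∈-++⁺ˡ (row-complete D a b y (s≤s⁻¹ ∣y∣<1+b) α≫0))
... | no  _ | inj₁ ∣y∣<1+b = row-complete D a b y (s≤s⁻¹ ∣y∣<1+b) α≫0
row-complete D a (suc b) (+ suc b) _ α≫0     | yes _ | inj₂ refl = here refl
row-complete D a (suc b) -[1+ b ]  _ α≫0     | yes _ | inj₂ refl = there (∈-++⁺ʳ (row D a b) (here refl))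
row-complete D a (suc b) (+ suc b) _ (_ , p) | no ≮  | inj₂ refl = ⊥-elim (≮ p)
row-complete D a (suc b) -[1+ b ]  _ (_ , p) | no ≮  | inj₂ refl = ⊥-elim (≮ p)

i*i≡∣i∣*∣i∣ : ∀ i → i ℤ.* i ≡ + (∣ i ∣ * ∣ i ∣)
i*i≡∣i∣*∣i∣ (+ n)    = sym (ℤₚ.pos-* n n)
i*i≡∣i∣*∣i∣ -[1+ n ] = refl

-- If a < |y|, then a² ≤ y² ≤ D y², against total positivity.
TotPos⇒∣y∣≤a : ∀ {D a y} → 1 ≤ D → TotPos D (+ a , y) → ∣ y ∣ ≤ a
TotPos⇒∣y∣≤a {suc D} {a} {y} _ (_ , p) = ℕₚ.≮⇒≥ λ a<∣y∣ → ℕₚ.<⇒≱ Dy²<a² (begin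
  a * a                   ≤⟨ ℕₚ.*-mono-≤ (ℕₚ.<⇒≤ a<∣y∣) (ℕₚ.<⇒≤ a<∣y∣) ⟩
  ∣ y ∣ * ∣ y ∣           ≤⟨ ℕₚ.m≤m+n _ _ ⟩
  suc D * (∣ y ∣ * ∣ y ∣) ∎)
  where
  open ℕₚ.≤-Reasoning
  Dy²<a² : suc D * (∣ y ∣ * ∣ y ∣) < a * a
  Dy²<a² = ℤₚ.drop‿+<+ (subst₂ ℤ._<_
    (trans (cong (+ suc D ℤ.*_) (i*i≡∣i∣*∣i∣ y)) (sym (ℤₚ.pos-* (suc D) _))) (i*i≡∣i∣*∣i∣ (+ a)) p)

ground-complete : ∀ {D n a y} → 1 ≤ D → a ≤ n → TotPos D (+ a , y) → (+ a , y) ∈ ground D n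
ground-complete {n = zero} {zero} _ z≤n (ℤ.+<+ () , _)
ground-complete {D} {suc n} {a} {y} 1≤D a≤1+n α≫0 with ℕₚ.m≤n⇒m<n∨m≡n a≤1+n
... | inj₁ a<1+n = ∈-++⁺ʳ (row D (suc n) (suc n)) (ground-complete 1≤D (s≤s⁻¹ a<1+n) α≫0)
... | inj₂ refl  = ∈-++⁺ˡ (row-complete D (suc n) (suc n) y (TotPos⇒∣y∣≤a {D} {suc n} {y} 1≤D α≫0) α≫0)

wt-sumOK-nonneg : ∀ {D xs} → All (TotPos D) xs → + 0 ℤ.≤ wt (sumOK xs)
wt-sumOK-nonneg []                = ℤₚ.≤-refl
wt-sumOK-nonneg {D} ((x>0 , _) ∷ xs≫0) = ℤₚ.+-mono-≤ (ℤₚ.<⇒≤ x>0) (wt-sumOK-nonneg {D} xs≫0)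

wt≤wt-sumOK : ∀ {D xs} → All (TotPos D) xs → All (λ x → wt x ℤ.≤ wt (sumOK xs)) xs
wt≤wt-sumOK []                         = []
wt≤wt-sumOK {D} {x ∷ xs} ((x>0 , _) ∷ xs≫0) =
  subst (ℤ._≤ wt x ℤ.+ wt (sumOK xs)) (ℤₚ.+-identityʳ (wt x)) (ℤₚ.+-monoʳ-≤ (wt x) (wt-sumOK-nonneg {D} xs≫0)) ∷
  All.map (λ {y} y≤ → subst (ℤ._≤ wt x ℤ.+ wt (sumOK xs)) (ℤₚ.+-identityˡ (wt y))
    (ℤₚ.+-mono-≤ (ℤₚ.<⇒≤ x>0) y≤)) (wt≤wt-sumOK {D} xs≫0)

-- No part outweighs the sum, so `ground D N` contains all parts that occur. One list serves all
-- `n ≤ N`, so a recurrence for its counts relates true partition numbers in that range.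
count-Partition : ∀ {D n N} → 1 ≤ D → n ≤ N → Fin (count (ground D N) (ι n)) ↔ Partition D (ι n)
count-Partition {D} {n} {N} 1≤D n≤N = ↔-trans (count-Multiset (ground-positive D N) (ι n))
  (Partition↔Multiset (ground-descending D N) (ground-TotPos D N) parts∈ground)
  where
  ∈ground : ∀ {α} → TotPos D α × wt α ℤ.≤ + n → α ∈ ground D N
  ∈ground {+ a , y} (α≫0 , ℤ.+≤+ a≤n) = ground-complete 1≤D (ℕₚ.≤-trans a≤n n≤N) α≫0
  parts∈ground : (P : Partition D (ι n)) → All (_∈ ground D N) (Partition.parts P)
  parts∈ground (mkPartition xs _ xs≫0 ≡n) = All.map ∈ground
    (All.zip (xs≫0 , subst (λ α → All (λ x → wt x ℤ.≤ wt α) xs) ≡n (wt≤wt-sumOK {D} xs≫0)))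

-- Cancellation of conjugate terms modulo 2.

sumOver-++ : ∀ h xs ys → sumOver h (xs ++ ys) ≡ sumOver h xs + sumOver h ys
sumOver-++ h xs ys = trans (cong sum (map-++ h xs ys)) (sum-++ (map h xs) (map h ys))

row-conj : ∀ D a b → ConjInvariant (row D a b)
row-conj D a zero    h = refl
row-conj D a (suc b) h with + D ℤ.* (+ suc b ℤ.* + suc b) ℤ.<? + a ℤ.* + a
... | no  _ = row-conj D a b h
... | yes _
  rewrite sumOver-++ (h ∘ conj) (row D a b) ((+ a , -[1+ b ]) ∷ [])
        | sumOver-++ h (row D a b) ((+ a , -[1+ b ]) ∷ [])
        | row-conj D a b h =
  exchange (h (+ a , -[1+ b ])) (sumOver h (row D a b)) (h (+ a , + suc b))
  where
  exchange : ∀ x s y → x + (s + (y + 0)) ≡ y + (s + (x + 0))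
  exchange = solve-∀

ground-conj : ∀ D n → ConjInvariant (ground D n)
ground-conj D zero    h = refl
ground-conj D (suc n) h = trans (sumOver-++ (h ∘ conj) (row D (suc n) (suc n)) (ground D n))
  (trans (cong₂ _+_ (row-conj D (suc n) (suc n) h) (ground-conj D n h))
    (sym (sumOver-++ h (row D (suc n) (suc n)) (ground D n))))

parity-m+n+m : ∀ m n → parity (m + (n + m)) ≡ parity n
parity-m+n+m zero    n = cong parity (ℕₚ.+-identityʳ n)
parity-m+n+m (suc m) n rewrite ℕₚ.+-suc n m | ℕₚ.+-suc m (n + m) = parity-m+n+m m n

-- The equal terms at a + b√D and a - b√D cancel, and the rational entry remains. Invariance is
-- asked at positive elements, where `geo≤-conj` provides it.
row-parity : ∀ D a b {h} → 1 ≤ a → (∀ α → Positive α → h (conj α) ≡ h α) → parity (sumOver h (row D a b)) ≡ parity (h (+ a , + 0))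
row-parity D a zero    {h} 1≤a h-conj = cong parity (ℕₚ.+-identityʳ (h (+ a , + 0)))
row-parity D a (suc b) {h} 1≤a h-conj with + D ℤ.* (+ suc b ℤ.* + suc b) ℤ.<? + a ℤ.* + a
... | no  _ = row-parity D a b 1≤a h-conj
... | yes _
  rewrite sumOver-++ h (row D a b) ((+ a , -[1+ b ]) ∷ []) | h-conj (+ a , + suc b) (positive (ℤ.+<+ 1≤a))
        | ℕₚ.+-identityʳ (h (+ a , + suc b)) =
  trans (parity-m+n+m (h (+ a , + suc b)) (sumOver h (row D a b))) (row-parity D a b 1≤a h-conj)

ground-parity : ∀ D n {h} → (∀ α → Positive α → h (conj α) ≡ h α) →
  parity (sumOver h (ground D n)) ≡ parity (Σ₁ n (λ a → h (+ a , + 0)))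
ground-parity D zero    h-conj = refl
ground-parity D (suc n) {h} h-conj = begin
  parity (sumOver h (row D (suc n) (suc n) ++ ground D n))
    ≡⟨ cong parity (sumOver-++ h (row D (suc n) (suc n)) (ground D n)) ⟩
  parity (sumOver h (row D (suc n) (suc n)) + sumOver h (ground D n))
    ≡⟨ ℙₚ.+-homo-+ (sumOver h (row D (suc n) (suc n))) _ ⟩
  parity (sumOver h (row D (suc n) (suc n))) ℙ.+ parity (sumOver h (ground D n))
    ≡⟨ cong₂ ℙ._+_ (row-parity D (suc n) (suc n) (s≤s z≤n) h-conj) (ground-parity D n h-conj) ⟩
  parity (h (+ suc n , + 0)) ℙ.+ parity (Σ₁ n (λ a → h (+ a , + 0)))
    ≡⟨ ℙₚ.+-homo-+ (h (+ suc n , + 0)) _ ⟨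
  parity (h (+ suc n , + 0) + Σ₁ n (λ a → h (+ a , + 0)))
    ≡⟨ cong parity (ℕₚ.+-comm (h (+ suc n , + 0)) _) ⟩
  parity (Σ₁ (suc n) (λ a → h (+ a , + 0))) ∎
  where open ≡-Reasoning

-- The recurrence with divisor sums.

𝟙[_∣_] : ℕ → ℕ → ℕ
𝟙[ a ∣ m ] with a ∣? m
... | yes _ = 1
... | no  _ = 0

-- The sum of the divisors of m only for 1 ≤ m ≤ N.
σ : ℕ → ℕ → ℕ
σ N m = Σ₁ N (λ a → a * 𝟙[ a ∣ m ])

𝟙-yes : ∀ {a m} → a ∣ m → 𝟙[ a ∣ m ] ≡ 1
𝟙-yes {a} {m} a∣m with a ∣? m
... | yes _   = refl
... | no  a∤m = ⊥-elim (a∤m a∣m)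

𝟙-no : ∀ {a m} → ¬ a ∣ m → 𝟙[ a ∣ m ] ≡ 0
𝟙-no {a} {m} a∤m with a ∣? m
... | yes a∣m = ⊥-elim (a∤m a∣m)
... | no  _   = refl

𝟙-cong : ∀ {a b m n} → (a ∣ m → b ∣ n) → (b ∣ n → a ∣ m) → 𝟙[ a ∣ m ] ≡ 𝟙[ b ∣ n ]
𝟙-cong {a} {b} {m} {n} to from with a ∣? m
... | yes a∣m = sym (𝟙-yes (to a∣m))
... | no  a∤m = sym (𝟙-no (a∤m ∘ from))

ι-⊖ : ∀ a n → ι (a + n) ⊖ (+ a , + 0) ≡ ι n
ι-⊖ a n = cong (_, + 0) (cancel (+ a) (+ n))
  where
  cancel : ∀ i j → i ℤ.+ j ℤ.- i ≡ j
  cancel = ℤSolver.solve-∀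

-- The left side sums `f` at n - k(a + 1) over k ≥ 1. Indexing by the multiple m = k(a + 1) brings
-- in the indicator from which `σ` is assembled.
geo-ι : ∀ {f} → Supported f → ∀ a n →
  geo (+ suc a , + 0) f (ι n ⊖ (+ suc a , + 0)) ≡ Σ₁ n (λ m → 𝟙[ suc a ∣ m ] * f (ι (n ∸ m)))
geo-ι {f} supp a n = go n n ℕₚ.≤-refl
  where
  open ≡-Reasoning
  e : OK
  e = + suc a , + 0
  e>0 : Positive e
  e>0 = positive (ℤ.+<+ (s≤s z≤n))
  term : ℕ → ℕ → ℕ
  term n m = 𝟙[ suc a ∣ m ] * f (ι (n ∸ m))
  term-zero : ∀ n m → 1 ≤ m → m ≤ a → term n m ≡ 0
  term-zero n (suc m) _ m≤a = cong (_* f (ι (n ∸ suc m))) (𝟙-no (λ d → ℕₚ.<⇒≱ (s≤s m≤a) (∣⇒≤ d)))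
  go : ∀ k n → n ≤ k → geo e f (ι n ⊖ e) ≡ Σ₁ n (term n)
  go k n n≤k with n ℕ.<? suc a
  ... | yes n<1+a = begin
    geo e f (ι n ⊖ e)
      ≡⟨ geo-supported e>0 supp (ι n ⊖ e) (subst (+ n ℤ.- + suc a ℤ.<_) (ℤₚ.+-inverseʳ (+ suc a))
           (ℤₚ.+-monoˡ-< (ℤ.- + suc a) (ℤ.+<+ n<1+a))) ⟩
    0              ≡⟨ Σ₁-zero n ⟨
    Σ₁ n (λ _ → 0) ≡⟨ Σ₁-cong n (λ m 1≤m m≤n → term-zero n m 1≤m (ℕₚ.≤-trans m≤n (s≤s⁻¹ n<1+a))) ⟨
    Σ₁ n (term n)  ∎
  go k n n≤k | no n≮1+a with ℕₚ.m≤n⇒∃[o]m+o≡n (ℕₚ.≮⇒≥ n≮1+a)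
  go (suc k) n (s≤s n≤k) | no _ | n′ , refl = begin
    geo e f (ι (suc a + n′) ⊖ e)
      ≡⟨ cong (geo e f) (ι-⊖ (suc a) n′) ⟩
    geo e f (ι n′)
      ≡⟨ geo-unfold e>0 supp (ι n′) ⟩
    f (ι n′) + geo e f (ι n′ ⊖ e)
      ≡⟨ cong (λ z → f (ι n′) + z) (go k n′ (ℕₚ.≤-trans (ℕₚ.m≤n+m n′ a) n≤k)) ⟩
    f (ι n′) + Σ₁ n′ (term n′)
      -- Among the indices up to a + 1 only m = a + 1 contributes; the later ones are those for
      -- `n′`, shifted by a + 1.
      ≡⟨ cong₂ _+_ head (Σ₁-cong n′ (λ m _ _ → shift m)) ⟩
    Σ₁ (suc a) (term (suc a + n′)) + Σ₁ n′ (λ m → term (suc a + n′) (suc a + m))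
      ≡⟨ Σ₁-split (suc a) n′ _ ⟨
    Σ₁ (suc a + n′) (term (suc a + n′)) ∎
    where
    head : f (ι n′) ≡ Σ₁ (suc a) (term (suc a + n′))
    head = sym (cong₂ _+_
      (trans (Σ₁-cong a (λ m 1≤m m≤a → term-zero (suc a + n′) m 1≤m m≤a)) (Σ₁-zero a))
      (trans (cong₂ _*_ (𝟙-yes (∣-refl {suc a})) (cong (f ∘ ι) (ℕₚ.m+n∸m≡n (suc a) n′)))
        (ℕₚ.*-identityˡ (f (ι n′)))))
    shift : ∀ m → term n′ m ≡ term (suc a + n′) (suc a + m)
    shift m = cong₂ _*_
      (𝟙-cong {suc a} {suc a} {m} {suc a + m} (∣m∣n⇒∣m+n ∣-refl) (λ d → ∣m+n∣m⇒∣n d ∣-refl))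
      (cong (f ∘ ι) (sym (ℕₚ.[m+n]∸[m+o]≡n∸o (suc a) n′ m)))

-- Conjugate summands of wt*count cancel modulo 2, leaving those with d ∈ ℤ.
count-recurrence : ∀ D N n → let p = λ m → count (ground D N) (ι m) in
  parity (n * p n) ≡ parity (Σ₁ n (λ m → σ N m * p (n ∸ m)))
count-recurrence D N n = begin
  parity (n * p n)
    ≡⟨ cong parity (wt*count (ground-positive D N) (ι n)) ⟩
  parity (sumOver h (ground D N))
    ≡⟨ ground-parity D N h-conj ⟩
  parity (Σ₁ N (λ a → h (+ a , + 0)))
    ≡⟨ cong parity (Σ₁-cong N (λ { (suc a) _ _ → cong (suc a *_) (geo-ι C-supp a n) })) ⟩
  parity (Σ₁ N (λ a → a * Σ₁ n (λ m → 𝟙[ a ∣ m ] * p (n ∸ m))))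
    ≡⟨ cong parity (Σ₁-cong N (λ a _ _ → Σ₁-*ˡ n a _)) ⟩
  parity (Σ₁ N (λ a → Σ₁ n (λ m → a * (𝟙[ a ∣ m ] * p (n ∸ m)))))
    -- Exchanging the sums gathers the coefficients of each p(n - m) into `σ N m`.
    ≡⟨ cong parity (Σ₁-swap N n _) ⟩
  parity (Σ₁ n (λ m → Σ₁ N (λ a → a * (𝟙[ a ∣ m ] * p (n ∸ m)))))
    ≡⟨ cong parity (Σ₁-cong n (λ m _ _ → trans
         (Σ₁-cong N (λ a _ _ → sym (ℕₚ.*-assoc a 𝟙[ a ∣ m ] (p (n ∸ m)))))
         (sym (Σ₁-*ʳ N (p (n ∸ m)) _)))) ⟩
  parity (Σ₁ n (λ m → σ N m * p (n ∸ m))) ∎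
  where
  open ≡-Reasoning
  p : ℕ → ℕ
  p m = count (ground D N) (ι m)
  C-supp : Supported (count (ground D N))
  C-supp = count-supported (ground-positive D N)
  h : OK → ℕ
  h d = ∣ wt d ∣ * geo d (count (ground D N)) (ι n ⊖ d)
  h-conj : ∀ d → Positive d → h (conj d) ≡ h d
  h-conj d d>0 = cong (∣ wt d ∣ *_) (trans
    (cong (geo (conj d) (count (ground D N))) (sym (conj-⊖ (ι n) d)))
    (geo≤-conj (suc K) d>0 (λ β _ → count-conj (ground-positive D N) (ground-conj D N) β)
      (suc K) (ι n ⊖ d) (<-suc-abs _)))
    where K = ∣ wt (ι n ⊖ d) ∣

-- The arguments at which the divisor sum is odd.

parity-even⇒double : ∀ n → parity n ≡ 0ℙ → ∃ λ k → n ≡ 2 * k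
parity-even⇒double zero          _ = 0 , refl
parity-even⇒double (suc (suc n)) p with parity-even⇒double n p
... | k , refl = suc k , sym (ℕₚ.*-suc 2 k)

∣-odd : ∀ {a m} → a ∣ m → parity m ≡ 1ℙ → parity a ≡ 1ℙ
∣-odd {a} (divides q refl) m-odd with parity q | parity a | trans (sym m-odd) (ℙₚ.*-homo-* q a)
... | 1ℙ | 1ℙ | _ = refl

odd⇒coprime-2 : ∀ {a} → parity a ≡ 1ℙ → Coprime a 2
odd⇒coprime-2 a-odd (d∣a , d∣2) with irreducible[2] d∣2
... | inj₁ d≡1  = d≡1
... | inj₂ refl with () ← ∣-odd d∣a a-odd

odd-parity-* : ∀ m n → parity m ≡ 1ℙ → parity (m * n) ≡ parity n
odd-parity-* m n m-odd rewrite ℙₚ.*-homo-* m n | m-odd = refl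

even-parity-* : ∀ m n → parity m ≡ 0ℙ → parity (m * n) ≡ 0ℙ
even-parity-* m n m-even rewrite ℙₚ.*-homo-* m n | m-even = refl

parity-*-even : ∀ m n → parity n ≡ 0ℙ → parity (m * n) ≡ 0ℙ
parity-*-even m n n-even rewrite ℙₚ.*-homo-* m n | n-even = ℙₚ.*-zeroʳ (parity m)

parity-*-odd : ∀ m n → parity n ≡ 1ℙ → parity (m * n) ≡ parity m
parity-*-odd m n n-odd rewrite ℙₚ.*-homo-* m n | n-odd = ℙₚ.*-identityʳ (parity m)

-- Even `a` contribute even terms, and an odd `a` divides 2m exactly when it divides m.
σ-double : ∀ N m → parity (σ N (2 * m)) ≡ parity (σ N m)
σ-double N m = Σ₁-cong-parity N λ a _ _ → term a (parity a) refl
  where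
  term : ∀ a p → parity a ≡ p → parity (a * 𝟙[ a ∣ 2 * m ]) ≡ parity (a * 𝟙[ a ∣ m ])
  term a 0ℙ a-even = trans (even-parity-* a 𝟙[ a ∣ 2 * m ] a-even) (sym (even-parity-* a 𝟙[ a ∣ m ] a-even))
  term a 1ℙ a-odd  = cong (λ z → parity (a * z)) (𝟙-cong {a} {a} {2 * m} {m}
    (coprime-divisor (odd⇒coprime-2 a-odd)) (λ { (divides q refl) → divides (2 * q) (sym (ℕₚ.*-assoc 2 q a)) }))

δ : ℕ → ℕ → ℕ
δ m n with m ℕ.≟ n
... | yes _ = 1
... | no  _ = 0

δ-≡ : ∀ {m n} → m ≡ n → δ m n ≡ 1
δ-≡ {m} {n} m≡n with m ℕ.≟ n
... | yes _   = refl
... | no  m≢n = ⊥-elim (m≢n m≡n)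

δ-≢ : ∀ {m n} → m ≢ n → δ m n ≡ 0
δ-≢ {m} {n} m≢n with m ℕ.≟ n
... | yes m≡n = ⊥-elim (m≢n m≡n)
... | no  _   = refl

δ-odd : ∀ {m n} → parity (δ m n) ≡ 1ℙ → m ≡ n
δ-odd {m} {n} p with m ℕ.≟ n
... | yes m≡n = m≡n

Σ₁-vanish : ∀ n {f : ℕ → ℕ} → (∀ i → 1 ≤ i → i ≤ n → f i ≡ 0) → Σ₁ n f ≡ 0
Σ₁-vanish n f≡0 = trans (Σ₁-cong n f≡0) (Σ₁-zero n)

Σ₁-single : ∀ n {f : ℕ → ℕ} k → 1 ≤ k → k ≤ n → f k ≡ 1 → (∀ i → 1 ≤ i → i ≢ k → f i ≡ 0) → Σ₁ n f ≡ 1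
Σ₁-single zero    (suc k) _ () _ _
Σ₁-single (suc n) {f} k 1≤k k≤1+n fk≡1 f≡0 with ℕₚ.m≤n⇒m<n∨m≡n k≤1+n
... | inj₁ k<1+n = cong₂ _+_ (Σ₁-single n k 1≤k (s≤s⁻¹ k<1+n) fk≡1 f≡0)
                     (f≡0 (suc n) (s≤s z≤n) (≢-sym (ℕₚ.<⇒≢ k<1+n)))
... | inj₂ refl  = cong₂ _+_ (Σ₁-vanish n (λ i 1≤i i≤n → f≡0 i 1≤i (ℕₚ.<⇒≢ (s≤s i≤n)))) fk≡1

Σ₁-odd : ∀ n f → parity (Σ₁ n f) ≡ 1ℙ → ∃ λ i → parity (f i) ≡ 1ℙ
Σ₁-odd (suc n) f p with parity (f (suc n)) in eq
... | 1ℙ = suc n , eq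
... | 0ℙ = Σ₁-odd n f (begin
  parity (Σ₁ n f)                        ≡⟨ ℙₚ.+-identityʳ _ ⟨
  parity (Σ₁ n f) ℙ.+ 0ℙ                 ≡⟨ cong (parity (Σ₁ n f) ℙ.+_) eq ⟨
  parity (Σ₁ n f) ℙ.+ parity (f (suc n)) ≡⟨ ℙₚ.+-homo-+ (Σ₁ n f) _ ⟨
  parity (Σ₁ n f + f (suc n))            ≡⟨ p ⟩
  1ℙ                                     ∎)
  where open ≡-Reasoning

-- Off the diagonal, the equal terms at (i, j) and (j, i) cancel.
Σ₁-symmetric : ∀ n (f : ℕ → ℕ → ℕ) → (∀ i j → f i j ≡ f j i) →
  parity (Σ₁ n (λ i → Σ₁ n (f i))) ≡ parity (Σ₁ n (λ i → f i i))
Σ₁-symmetric zero    f f-sym = refl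
Σ₁-symmetric (suc n) f f-sym = begin
  parity (Σ₁ n (λ i → Σ₁ n (f i) + f i (suc n)) + (R + d))
    ≡⟨ cong (λ z → parity (z + (R + d))) (Σ₁-+ n _ _) ⟩
  parity (S + Σ₁ n (λ i → f i (suc n)) + (R + d))
    ≡⟨ cong (λ z → parity (S + z + (R + d))) (Σ₁-cong n (λ i _ _ → f-sym i (suc n))) ⟩
  parity (S + R + (R + d))
    ≡⟨ cong parity (regroup S R d) ⟩
  parity (R + (S + d + R))
    ≡⟨ parity-m+n+m R (S + d) ⟩
  parity (S + d)
    ≡⟨ ℙₚ.+-homo-+ S d ⟩
  parity S ℙ.+ parity d
    ≡⟨ cong (ℙ._+ parity d) (Σ₁-symmetric n f f-sym) ⟩
  parity (Σ₁ n (λ i → f i i)) ℙ.+ parity d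
    ≡⟨ ℙₚ.+-homo-+ (Σ₁ n (λ i → f i i)) d ⟨
  parity (Σ₁ n (λ i → f i i) + d) ∎
  where
  open ≡-Reasoning
  S = Σ₁ n (λ i → Σ₁ n (f i))
  R = Σ₁ n (f (suc n))
  d = f (suc n) (suc n)
  regroup : ∀ s r d → s + r + (r + d) ≡ r + (s + d + r)
  regroup = solve-∀

-- The sum detects the cofactor of `a` in `m`, which is at most `N`. A divisor count thus becomes a
-- double sum symmetric in divisor and cofactor.
𝟙-as-sum : ∀ {N a m} → 1 ≤ a → 1 ≤ m → m ≤ N → 𝟙[ a ∣ m ] ≡ Σ₁ N (λ k → δ (a * k) m)
𝟙-as-sum {N} {a} {m} 1≤a 1≤m m≤N with a ∣? m
... | no a∤m = sym (Σ₁-vanish N (λ k _ _ → δ-≢ (λ eq → a∤m (divides k (trans (sym eq) (ℕₚ.*-comm a k))))))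
𝟙-as-sum {N} {a@(suc _)} {m} 1≤a () m≤N | yes (divides zero refl)
𝟙-as-sum {N} {a@(suc _)} {m} 1≤a 1≤m m≤N | yes (divides q@(suc _) refl) = sym (Σ₁-single N q (s≤s z≤n)
  (ℕₚ.≤-trans (ℕₚ.m≤m*n q a) m≤N) (δ-≡ (ℕₚ.*-comm a q))
  (λ k _ k≢q → δ-≢ (λ eq → k≢q (ℕₚ.*-cancelˡ-≡ k q a (trans eq (ℕₚ.*-comm q a))))))

-- All divisors of an odd `m` are odd, so their sum has the parity of their number. Swapping divisor
-- and cofactor pairs them off, except for a square root of `m`.
σ-odd-argument : ∀ {N m} → 1 ≤ m → m ≤ N → parity m ≡ 1ℙ →
  parity (σ N m) ≡ parity (Σ₁ N (λ a → δ (a * a) m))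
σ-odd-argument {N} {m} 1≤m m≤N m-odd = begin
  parity (σ N m)
    ≡⟨ Σ₁-cong-parity N term ⟩
  parity (Σ₁ N (λ a → 𝟙[ a ∣ m ]))
    ≡⟨ cong parity (Σ₁-cong N (λ a 1≤a _ → 𝟙-as-sum 1≤a 1≤m m≤N)) ⟩
  parity (Σ₁ N (λ a → Σ₁ N (λ k → δ (a * k) m)))
    ≡⟨ Σ₁-symmetric N _ (λ a k → cong (λ z → δ z m) (ℕₚ.*-comm a k)) ⟩
  parity (Σ₁ N (λ a → δ (a * a) m)) ∎
  where
  open ≡-Reasoning
  term : ∀ a → 1 ≤ a → a ≤ N → parity (a * 𝟙[ a ∣ m ]) ≡ parity 𝟙[ a ∣ m ]
  term a _ _ with a ∣? m
  ... | yes a∣m = odd-parity-* a 1 (∣-odd a∣m m-odd)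
  ... | no  _   = cong parity (ℕₚ.*-zeroʳ a)

-- For odd `m`, `σ-odd-argument` yields a square root. Even `m` are halved by `σ-double`; doubling
-- back turns r² into 2r² and 2r² into (2r)².
σ-odd⇒square : ∀ {N m} → 1 ≤ m → m ≤ N → parity (σ N m) ≡ 1ℙ → ∃ λ r → m ≡ r * r ⊎ m ≡ 2 * (r * r)
σ-odd⇒square {N} {m} = go m m ℕₚ.≤-refl
  where
  go : ∀ k m → m ≤ k → 1 ≤ m → m ≤ N → parity (σ N m) ≡ 1ℙ → ∃ λ r → m ≡ r * r ⊎ m ≡ 2 * (r * r)
  go k m m≤k 1≤m m≤N σ-odd with parity m in eq
  ... | 1ℙ = let r , p = Σ₁-odd N _ (trans (sym (σ-odd-argument 1≤m m≤N eq)) σ-odd)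
             in r , inj₁ (sym (δ-odd p))
  ... | 0ℙ with parity-even⇒double m eq
  go (suc k) m m≤k () m≤N σ-odd | 0ℙ | zero , refl
  go (suc k) m m≤k 1≤m m≤N σ-odd | 0ℙ | h@(suc _) , refl
    with go k h (s≤s⁻¹ (ℕₚ.≤-trans (ℕₚ.m<m*n h 2 (s≤s (s≤s z≤n))) (ℕₚ.≤-trans (ℕₚ.≤-reflexive (ℕₚ.*-comm h 2)) m≤k)))
              (s≤s z≤n) (ℕₚ.≤-trans (ℕₚ.m≤n*m h 2) m≤N) (trans (sym (σ-double N h)) σ-odd)
  ... | r , inj₁ h≡r²  = r , inj₂ (cong (2 *_) h≡r²)
  ... | r , inj₂ h≡2r² = 2 * r , inj₁ (trans (cong (2 *_) h≡2r²) (square r))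
    where
    square : ∀ r → 2 * (2 * (r * r)) ≡ 2 * r * (2 * r)
    square = solve-∀

-- `σ-double` descends to σ(1) = 1. Powers of 2 provide odd values beyond every gap.
σ-power-of-2 : ∀ {N} e → 1 ≤ N → parity (σ N (2 ^ e)) ≡ 1ℙ
σ-power-of-2 {N} zero    1≤N = cong parity (Σ₁-single N 1 ℕₚ.≤-refl 1≤N refl
  (λ a _ a≢1 → trans (cong (a *_) (𝟙-no (a≢1 ∘ ∣1⇒≡1))) (ℕₚ.*-zeroʳ a)))
σ-power-of-2 {N} (suc e) 1≤N = trans (σ-double N (2 ^ e)) (σ-power-of-2 e 1≤N)

-- Long intervals on which the divisor sum is even.

-- Finiteness of the interval makes the case distinction constructive, so later contradictions still
-- yield witnesses.
search : ∀ (P : ℕ → Parity) p lo hi →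
  (∀ i → lo < i → i ≤ hi → P i ≡ p) ⊎ (∃ λ i → lo < i × i ≤ hi × P i ≡ p ⁻¹)
search P p lo zero = inj₁ (λ i lo<i i≤0 → ⊥-elim (ℕₚ.<⇒≱ lo<i (ℕₚ.≤-trans i≤0 z≤n)))
search P p lo (suc hi) with search P p lo hi
... | inj₂ (i , lo<i , i≤hi , eq) = inj₂ (i , lo<i , ℕₚ.m≤n⇒m≤1+n i≤hi , eq)
... | inj₁ all with lo ℕ.<? suc hi
...   | no lo≮ = inj₁ (λ i lo<i i≤ → ⊥-elim (lo≮ (ℕₚ.≤-trans lo<i i≤)))
...   | yes lo< with dichotomy (P (suc hi)) p
  where
  dichotomy : ∀ q p → q ≡ p ⊎ q ≡ p ⁻¹
  dichotomy 0ℙ 0ℙ = inj₁ refl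
  dichotomy 0ℙ 1ℙ = inj₂ refl
  dichotomy 1ℙ 0ℙ = inj₂ refl
  dichotomy 1ℙ 1ℙ = inj₁ refl
...     | inj₂ eq = inj₂ (suc hi , lo< , ℕₚ.≤-refl , eq)
...     | inj₁ eq = inj₁ extend
  where
  extend : ∀ i → lo < i → i ≤ suc hi → P i ≡ p
  extend i lo<i i≤ with ℕₚ.m≤n⇒m<n∨m≡n i≤
  ... | inj₁ i<   = all i lo<i (s≤s⁻¹ i<)
  ... | inj₂ refl = eq

no-square-between : ∀ {s r} → s * s < r * r → r * r < suc s * suc s → ⊥
no-square-between {s} {r} s²<r² r²<[1+s]² with r ℕ.≤? s
... | yes r≤s = ℕₚ.<⇒≱ s²<r² (ℕₚ.*-mono-≤ r≤s r≤s)
... | no  r≰s = ℕₚ.<⇒≱ r²<[1+s]² (ℕₚ.*-mono-≤ (ℕₚ.≰⇒> r≰s) (ℕₚ.≰⇒> r≰s))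

-- Since q + 1 ≤ r, 2q² + 4q + 2 ≤ 2r² ≤ s² + 2s, which with s² < 2q² gives 2q ≤ s. Then 2q² ≤ 4q² ≤
-- s², a contradiction.
twice-squares-apart : ∀ {s q r} → s * s < 2 * (q * q) → 2 * (q * q) < 2 * (r * r) →
  2 * (r * r) ≤ s * s + 2 * s → ⊥
twice-squares-apart {s} {q} {r} s²<2q² 2q²<2r² 2r²≤s²+2s = ℕₚ.<⇒≱ s²<2q² (begin
  2 * (q * q)     ≤⟨ ℕₚ.*-monoˡ-≤ (q * q) {2} {4} (s≤s (s≤s z≤n)) ⟩
  4 * (q * q)     ≡⟨ square q ⟩
  2 * q * (2 * q) ≤⟨ ℕₚ.*-mono-≤ 2q≤s 2q≤s ⟩
  s * s           ∎)
  where
  open ℕₚ.≤-Reasoning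
  square : ∀ q → 4 * (q * q) ≡ 2 * q * (2 * q)
  square = solve-∀
  expand : ∀ q → 2 * (q * q) + 2 * (2 * q) + 2 ≡ 2 * (suc q * suc q)
  expand = solve-∀
  q<r : q < r
  q<r = ℕₚ.≰⇒> (λ r≤q → ℕₚ.<⇒≱ 2q²<2r² (ℕₚ.*-monoʳ-≤ 2 (ℕₚ.*-mono-≤ r≤q r≤q)))
  2q≤s : 2 * q ≤ s
  2q≤s = ℕₚ.*-cancelˡ-≤ 2 (ℕₚ.+-cancelˡ-≤ (s * s) (2 * (2 * q)) (2 * s) (begin
    s * s + 2 * (2 * q)           ≤⟨ ℕₚ.+-monoˡ-≤ (2 * (2 * q)) (ℕₚ.<⇒≤ s²<2q²) ⟩
    2 * (q * q) + 2 * (2 * q)     ≤⟨ ℕₚ.m≤m+n _ 2 ⟩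
    2 * (q * q) + 2 * (2 * q) + 2 ≡⟨ expand q ⟩
    2 * (suc q * suc q)           ≤⟨ ℕₚ.*-monoʳ-≤ 2 (ℕₚ.*-mono-≤ q<r q<r) ⟩
    2 * (r * r)                   ≤⟨ 2r²≤s²+2s ⟩
    s * s + 2 * s                 ∎))

EvenOn : ℕ → ℕ → ℕ → Set
EvenOn N lo hi = ∀ m → lo < m → m ≤ hi → parity (σ N m) ≡ 0ℙ

m+n+n≡m+2*n : ∀ m n → m + n + n ≡ m + 2 * n
m+n+n≡m+2*n = solve-∀

-- Strictly between s² and (s + 1)² there is no square and at most one double of a square. Of the
-- two halves of length s, at least one avoids it.
σ-gap : ∀ {N s} → s * s + 2 * s ≤ N →
  ∃ λ x → x + s ≤ s * s + 2 * s × EvenOn N x (x + s)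
σ-gap {N} {s} bound
  with search (parity ∘ σ N) 0ℙ (s * s) (s * s + s) | search (parity ∘ σ N) 0ℙ (s * s + s) (s * s + s + s)
... | inj₁ even | _ = s * s , ℕₚ.+-monoʳ-≤ (s * s) (ℕₚ.m≤n*m s 2) , even
... | inj₂ _ | inj₁ even = s * s + s , ℕₚ.≤-reflexive (m+n+n≡m+2*n (s * s) s) , even
... | inj₂ (m , s²<m , m≤s²+s , σm-odd) | inj₂ (n , s²+s<n , n≤s²+s+s , σn-odd) =
  ⊥-elim (both (twice-square s²<m (ℕₚ.≤-trans (ℕₚ.<⇒≤ m<n) n≤) σm-odd)
               (twice-square (ℕₚ.<-trans s²<m m<n) n≤ σn-odd))
  where
  next-square : ∀ s → suc (s * s + 2 * s) ≡ suc s * suc s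
  next-square = solve-∀
  m<n : m < n
  m<n = ℕₚ.≤-<-trans m≤s²+s s²+s<n
  n≤ : n ≤ s * s + 2 * s
  n≤ = ℕₚ.≤-trans n≤s²+s+s (ℕₚ.≤-reflexive (m+n+n≡m+2*n (s * s) s))
  twice-square : ∀ {m} → s * s < m → m ≤ s * s + 2 * s → parity (σ N m) ≡ 1ℙ → ∃ λ r → m ≡ 2 * (r * r)
  twice-square s²<m m≤ odd with σ-odd⇒square (ℕₚ.≤-trans (s≤s z≤n) s²<m) (ℕₚ.≤-trans m≤ bound) odd
  ... | r , inj₁ refl = ⊥-elim (no-square-between {s} {r} s²<m (ℕₚ.≤-trans (s≤s m≤) (ℕₚ.≤-reflexive (next-square s))))
  ... | r , inj₂ eq   = r , eq
  both : (∃ λ q → m ≡ 2 * (q * q)) → (∃ λ r → n ≡ 2 * (r * r)) → ⊥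
  both (q , refl) (r , refl) = twice-squares-apart {s} {q} {r} s²<m m<n n≤

-- The even stretch is extended to the right until σ is odd; the known odd value at `z + d` bounds
-- the walk.
first-odd : ∀ N {x} z d → x < z → EvenOn N x z → parity (σ N (z + d)) ≡ 1ℙ →
  ∃ λ k → z ≤ k × k < z + d × EvenOn N x k × parity (σ N (suc k)) ≡ 1ℙ
first-odd N z zero x<z even odd rewrite ℕₚ.+-identityʳ z
  with () ← trans (sym odd) (even z x<z ℕₚ.≤-refl)
first-odd N {x} z (suc d) x<z even odd with parity (σ N (suc z)) in eq
... | 1ℙ = z , ℕₚ.≤-refl , ℕₚ.m<m+n z (s≤s z≤n) , even , eq
... | 0ℙ rewrite ℕₚ.+-suc z d =
  let k , z<k , k< , even′ , odd′ = first-odd N (suc z) d (ℕₚ.m≤n⇒m≤1+n x<z) even′′ odd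
  in k , ℕₚ.<⇒≤ z<k , k< , even′ , odd′
  where
  even′′ : EvenOn N x (suc z)
  even′′ m x<m m≤ with ℕₚ.m≤n⇒m<n∨m≡n m≤
  ... | inj₁ m<   = even m x<m (s≤s⁻¹ m<)
  ... | inj₂ refl = eq

n<2^n : ∀ n → n < 2 ^ n
n<2^n zero    = s≤s z≤n
n<2^n (suc n) = begin-strict
  suc n         <⟨ s≤s (n<2^n n) ⟩
  1 + 2 ^ n     ≤⟨ ℕₚ.+-monoˡ-≤ (2 ^ n) (ℕₚ.≤-trans (s≤s z≤n) (n<2^n n)) ⟩
  2 ^ n + 2 ^ n ≡⟨ cong (λ z → 2 ^ n + z) (sym (ℕₚ.+-identityʳ (2 ^ n))) ⟩
  2 ^ suc n     ∎
  where open ℕₚ.≤-Reasoning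

parity-suc : ∀ n → parity (suc n) ≢ parity n
parity-suc zero    ()
parity-suc (suc n) eq = parity-suc n (sym eq)

-- Both parities occur, from the recurrence and p(0) = 1.

module Recurrence (B : ℕ) (p : ℕ → ℕ) (p₀ : p 0 ≡ 1)
  (recurrence : ∀ n → parity (n * p n) ≡ parity (Σ₁ n (λ m → σ B m * p (n ∸ m)))) where

  -- If p were even on (N, k + 1], the recurrence at k + 1 would have an even left side. On the
  -- right, terms with m ≤ x are even through p, those with x < m ≤ k through σ, and the last, σ(k +
  -- 1) p(0), is odd.
  some-odd : ∀ N {x k} → x + N ≤ k → EvenOn B x k → parity (σ B (suc k)) ≡ 1ℙ →
    ∃ λ n → N < n × n ≤ suc k × parity (p n) ≡ 1ℙ
  some-odd N {x} {k} x+N≤k even σ-odd with search (parity ∘ p) 0ℙ N (suc k)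
  ... | inj₂ found    = found
  ... | inj₁ all-even = contradiction (begin
    0ℙ
      ≡⟨ parity-*-even (suc k) (p (suc k)) (all-even (suc k) (s≤s (ℕₚ.≤-trans (ℕₚ.m≤n+m N x) x+N≤k)) ℕₚ.≤-refl) ⟨
    parity (suc k * p (suc k))
      ≡⟨ recurrence (suc k) ⟩
    parity (Σ₁ k term + term (suc k))
      ≡⟨ ℙₚ.+-homo-+ (Σ₁ k term) _ ⟩
    parity (Σ₁ k term) ℙ.+ parity (term (suc k))
      ≡⟨ cong₂ ℙ._+_ (trans (Σ₁-cong-parity k {g = λ _ → 0} (λ m _ m≤k → term-even m m≤k)) (cong parity (Σ₁-zero k))) last ⟩
    1ℙ ∎) λ ()
    where
    open ≡-Reasoning
    term : ℕ → ℕ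
    term m = σ B m * p (suc k ∸ m)
    last : parity (term (suc k)) ≡ 1ℙ
    last = trans (parity-*-odd (σ B (suc k)) (p (suc k ∸ suc k)) (cong parity (trans (cong p (ℕₚ.n∸n≡0 (suc k))) p₀))) σ-odd
    term-even : ∀ m → m ≤ k → parity (term m) ≡ 0ℙ
    term-even m m≤k with x ℕ.<? m
    ... | yes x<m = even-parity-* (σ B m) (p (suc k ∸ m)) (even m x<m m≤k)
    -- From m ≤ x and x + N ≤ k, the index k + 1 - m still exceeds N.
    ... | no  x≮m = parity-*-even (σ B m) (p (suc k ∸ m)) (all-even (suc k ∸ m)
      (ℕₚ.m+n≤o⇒m≤o∸n (suc N) (s≤s (ℕₚ.≤-trans
        (ℕₚ.≤-trans (ℕₚ.+-monoʳ-≤ N (ℕₚ.≮⇒≥ x≮m)) (ℕₚ.≤-reflexive (ℕₚ.+-comm N x))) x+N≤k)))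
      (ℕₚ.m∸n≤m (suc k) m))

  -- If p were odd on (N, k + 1], then n ≡ σ(1) + ... + σ(n) modulo 2 for n = k and n = k + 1: the
  -- factor p(n - m) is odd for m ≤ x, and σ(m) is even for m > x. As σ(k + 1) is even, k and k + 1
  -- would agree in parity.
  some-even : ∀ N {x k} → x + N < k → EvenOn B x (suc k) →
    ∃ λ n → N < n × n ≤ suc k × parity (p n) ≡ 0ℙ
  some-even N {x} {k} x+N<k even with search (parity ∘ p) 1ℙ N (suc k)
  ... | inj₂ found   = found
  ... | inj₁ all-odd = contradiction (begin
    parity (suc k)                             ≡⟨ parity≡ (suc k) (ℕₚ.<-trans x+N<k ℕₚ.≤-refl) ℕₚ.≤-refl ⟩
    parity (Σ₁ k (σ B) + σ B (suc k))          ≡⟨ ℙₚ.+-homo-+ (Σ₁ k (σ B)) _ ⟩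
    parity (Σ₁ k (σ B)) ℙ.+ parity (σ B (suc k))
      ≡⟨ cong (parity (Σ₁ k (σ B)) ℙ.+_) (even (suc k) (ℕₚ.<-trans (ℕₚ.m+n≤o⇒m≤o (suc x) x+N<k) ℕₚ.≤-refl) ℕₚ.≤-refl) ⟩
    parity (Σ₁ k (σ B)) ℙ.+ 0ℙ                 ≡⟨ ℙₚ.+-identityʳ _ ⟩
    parity (Σ₁ k (σ B))                        ≡⟨ parity≡ k x+N<k (ℕₚ.n≤1+n k) ⟨
    parity k                                   ∎) (parity-suc k)
    where
    open ≡-Reasoning
    parity≡ : ∀ n → x + N < n → n ≤ suc k → parity n ≡ parity (Σ₁ n (σ B))
    parity≡ n x+N<n n≤1+k = begin
      parity n
        ≡⟨ parity-*-odd n (p n) (all-odd n (ℕₚ.≤-<-trans (ℕₚ.m≤n+m N x) x+N<n) n≤1+k) ⟨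
      parity (n * p n)
        ≡⟨ recurrence n ⟩
      parity (Σ₁ n (λ m → σ B m * p (n ∸ m)))
        ≡⟨ Σ₁-cong-parity n (λ m _ m≤n → term m m≤n) ⟩
      parity (Σ₁ n (σ B)) ∎
      where
      term : ∀ m → m ≤ n → parity (σ B m * p (n ∸ m)) ≡ parity (σ B m)
      term m m≤n with x ℕ.<? m
      ... | yes x<m = let σ-even = even m x<m (ℕₚ.≤-trans m≤n n≤1+k)
                      in trans (even-parity-* (σ B m) (p (n ∸ m)) σ-even) (sym σ-even)
      ... | no  x≮m = parity-*-odd (σ B m) (p (n ∸ m)) (all-odd (n ∸ m)
        (ℕₚ.m+n≤o⇒m≤o∸n (suc N) (ℕₚ.≤-trans
          (s≤s (ℕₚ.≤-trans (ℕₚ.+-monoʳ-≤ N (ℕₚ.≮⇒≥ x≮m)) (ℕₚ.≤-reflexive (ℕₚ.+-comm N x)))) x+N<n))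
        (ℕₚ.≤-trans (ℕₚ.m∸n≤m n m) n≤1+k))

-- Choice of the bounds and conclusion.

parity-odd⇒Odd : ∀ n → parity n ≡ 1ℙ → Odd n
parity-odd⇒Odd 1             _ = refl
parity-odd⇒Odd (suc (suc n)) p = parity-odd⇒Odd n p

parity-even⇒Even : ∀ n → parity n ≡ 0ℙ → Even n
parity-even⇒Even zero          _ = refl
parity-even⇒Even (suc (suc n)) p = parity-even⇒Even n p

-- s is kept a variable because 2 ^ (s * s + 2 * s) would unfold at s = 2 + N.
count-parities : ∀ D N s → 2 + N ≡ s → let p = λ B n → count (ground D B) (ι n) in
  (∃ λ B → ∃ λ n → N < n × n ≤ B × parity (p B n) ≡ 1ℙ) ×
  (∃ λ B → ∃ λ n → N < n × n ≤ B × parity (p B n) ≡ 0ℙ)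
count-parities D N s 2+N≡s = (B , odd) , (B , even)
  where
  -- A power of 2 beyond the gap, where σ is odd. Every `n` found is at most `B`, where `count` is
  -- the true partition number.
  B = 2 ^ (s * s + 2 * s)
  p : ℕ → ℕ
  p n = count (ground D B) (ι n)
  bound : s * s + 2 * s < B
  bound = n<2^n (s * s + 2 * s)
  x+s≡ : ∀ x → x + s ≡ 2 + (x + N)
  x+s≡ x = trans (cong (λ z → x + z) (sym 2+N≡s)) (trans (ℕₚ.+-suc x (suc N)) (cong suc (ℕₚ.+-suc x N)))
  open Recurrence B p (count-wt-zero (ground-positive D B) (+ 0)) (count-recurrence D B)

  odd : ∃ λ n → N < n × n ≤ B × parity (p n) ≡ 1ℙ
  odd with x , x+s≤ , gap ← σ-gap {B} {s} (ℕₚ.<⇒≤ bound)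
      with d , x+s+d≡B ← ℕₚ.m≤n⇒∃[o]m+o≡n (ℕₚ.≤-trans x+s≤ (ℕₚ.<⇒≤ bound))
      with k , x+s≤k , k<x+s+d , gap′ , σ-odd ← first-odd B (x + s) d (ℕₚ.m<m+n x (ℕₚ.≤-trans (s≤s z≤n) (ℕₚ.≤-reflexive 2+N≡s))) gap
             (trans (cong (parity ∘ σ B) x+s+d≡B)
               (σ-power-of-2 (s * s + 2 * s) (ℕₚ.≤-trans (s≤s z≤n) bound)))
      with n , N<n , n≤1+k , pn-odd ← some-odd N (ℕₚ.≤-trans (ℕₚ.+-monoʳ-≤ x (ℕₚ.≤-trans (ℕₚ.m≤n+m N 2) (ℕₚ.≤-reflexive 2+N≡s))) x+s≤k) gap′ σ-odd
    = n , N<n , ℕₚ.≤-trans n≤1+k (ℕₚ.≤-trans k<x+s+d (ℕₚ.≤-reflexive x+s+d≡B)) , pn-odd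

  even : ∃ λ n → N < n × n ≤ B × parity (p n) ≡ 0ℙ
  even with x , x+s≤ , gap ← σ-gap {B} {s} (ℕₚ.<⇒≤ bound)
       -- The least `k` that `some-even` admits is x + N + 1. The interval (x, k + 1] then has
       -- length N + 2, whence the choice of `s`.
       with n , N<n , n≤x+s , pn-even ← some-even N {x} {suc (x + N)} ℕₚ.≤-refl
              (subst (EvenOn B x) (x+s≡ x) gap)
    = n , N<n , ℕₚ.≤-trans n≤x+s (ℕₚ.≤-trans
        (ℕₚ.≤-reflexive (sym (x+s≡ x)))
        (ℕₚ.≤-trans x+s≤ (ℕₚ.<⇒≤ bound))) , pn-even

theorem1p2 : (D : ℕ) → 2 ≤ D → SquareFree D → (D % 4 ≡ 2 ⊎ D % 4 ≡ 3) →
    ((N : ℕ) → Σ ℕ (λ n → N ≤ n × 1 ≤ n × Σ ℕ (λ m → (Fin m ↔ Partition D (ι n)) × Odd m)))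
    × ((N : ℕ) → Σ ℕ (λ n → N ≤ n × 1 ≤ n × Σ ℕ (λ m → (Fin m ↔ Partition D (ι n)) × Even m)))
theorem1p2 D 2≤D _ _ = odd , even
  where
  1≤D : 1 ≤ D
  1≤D = ℕₚ.<⇒≤ 2≤D
  odd : (N : ℕ) → Σ ℕ (λ n → N ≤ n × 1 ≤ n × Σ ℕ (λ m → (Fin m ↔ Partition D (ι n)) × Odd m))
  odd N = let B , n , N<n , n≤B , p = proj₁ (count-parities D N (2 + N) refl) in
    n , ℕₚ.<⇒≤ N<n , ℕₚ.≤-trans (s≤s z≤n) N<n ,
    count (ground D B) (ι n) , count-Partition 1≤D n≤B , parity-odd⇒Odd (count (ground D B) (ι n)) p
  even : (N : ℕ) → Σ ℕ (λ n → N ≤ n × 1 ≤ n × Σ ℕ (λ m → (Fin m ↔ Partition D (ι n)) × Even m))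
  even N = let B , n , N<n , n≤B , p = proj₂ (count-parities D N (2 + N) refl) in
    n , ℕₚ.<⇒≤ N<n , ℕₚ.≤-trans (s≤s z≤n) N<n ,
    count (ground D B) (ι n) , count-Partition 1≤D n≤B , parity-even⇒Even (count (ground D B) (ι n)) p
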